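{- Let $\Sigma=\langle Z,\le,\mathsf w,U\rangle$ be any subexponential signature and let $\hat\Sigma$ be its split form. The encoding $E$ (defined in the context) of sequents of focused intuitionistic subexponential logic $\mathrm{ISL}(\Sigma)$ as sequents of focused classical subexponential logic $\mathrm{CSL}(\hat\Sigma)$ is focally adequate. That is, for every neutral sequent $S$ of $\mathrm{ISL}(\Sigma)$ there is a bijection between the synthetic derivations of $\mathrm{ISL}(\Sigma)$ with conclusion $S$ and the synthetic derivations of $\mathrm{CSL}(\hat\Sigma)$ with conclusion $E(S)$, under which a synthetic derivation with open premises $S_1,\dots,S_n$ corresponds to one with open premises $E(S_1),\dots,E(S_n)$.
   Context: **Signatures.** A subexponential signature is $\Sigma=\langle Z,\le,\mathsf w,U\rangle$ where $\langle Z,\le\rangle$ is a non-empty preordered set (of "zones"), $\mathsf w\in Z$ is the working zone, and $U\subseteq Z$ (the unrestricted zones) is upward closed: $z_1\le z_2$ and $z_1\in U$ imply $z_2\in U$. Zones in $Z\setminus U$ are restricted. Letters $u$ range over unrestricted zones, $r$ over restricted zones, $x,y,z$ over all zones. **Formulas.** Each atom is either positive ($p,q$) or negative ($n,m$). Classical formulas: positive $P,Q::=p\mid P\otimes Q\mid 1\mid P\oplus Q\mid 0\mid\ !_z\check N$; negative $N,M::=n\mid N\& M\mid\top\mid N⅋ M\mid\bot\mid P\multimap N\mid\ ?_z\hat P$. Here $z\in Z$, $\hat P$ (or $\hat Q$) denotes a positive formula or a negative atom, and $\check N$ denotes a negative formula or a positive atom. Intuitionistic formulas are the same without $⅋$ and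 $\bot$. $A$ is an arbitrary formula and $a$ an arbitrary atom. **Contexts.** $\Gamma$ (left passive): elements $z{:}\check N$. $\Delta$ (right passive): elements $z{:}\hat P$. $\Omega$ (left active): elements $\hat P$. $\Xi$ (right active): elements $\check N$. Contexts are finite multisets of occurrences; derivations that act on different occurrences are counted as different. $\Gamma^u,\Delta^u$ denote passive contexts all of whose zones are unrestricted; $\Gamma^r_i,\Delta^r_i$ denote passive contexts all of whose zones are restricted. **Focused calculus $\mathrm{CSL}(\Sigma)$.** Sequents: $\Gamma\vdash[P];\Delta$ (right focus), $\Gamma;[N]\vdash\Delta$ (left focus), $\Gamma;\Omega\vdash\Xi;\Delta$ (active). Rules (premises $\Rightarrow$ conclusion; "$\Rightarrow S$" means no premises): - Right focus: $\Rightarrow\Gamma^u,z{:}p\vdash[p];\Delta^u$ (any $z$). From $\Gamma^u,\Gamma^r_1\vdash[P];\Delta^u,\Delta^r_1$ and $\Gamma^u,\Gamma^r_2\vdash[Q];\Delta^u,\Delta^r_2$ infer $\Gamma^u,\Gamma^r_1,\Gamma^r_2\vdash[P\otimes Q];\Delta^u,\Delta^r_1,\Delta^r_2$. $\Rightarrow\Gamma^u\vdash[1];\Delta^u$. $\Gamma\vdash[P_i];\Delta\Rightarrow\Gamma\vdash[P_1\oplus P_2];\Delta$ ($i=1,2$). $\Gamma;\cdot\vdash\check N;\Delta\Rightarrow\Gamma\vdash[!_z\check N];\Delta$ provided $z\le x$ for all $x{:}A$ in $\Gamma,\Delta$. (No rule for $0$.) - Left focus: $\Rightarrow\Gamma^u;[n]\vdash\Delta^u,z{:}n$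 (any $z$). $\Gamma;[N_i]\vdash\Delta\Rightarrow\Gamma;[N_1\& N_2]\vdash\Delta$. From $\Gamma^u,\Gamma^r_1;[N]\vdash\Delta^u,\Delta^r_1$ and $\Gamma^u,\Gamma^r_2;[M]\vdash\Delta^u,\Delta^r_2$ infer $\Gamma^u,\Gamma^r_1,\Gamma^r_2;[N⅋ M]\vdash\Delta^u,\Delta^r_1,\Delta^r_2$. $\Rightarrow\Gamma^u;[\bot]\vdash\Delta^u$. From $\Gamma^u,\Gamma^r_1\vdash[P];\Delta^u,\Delta^r_1$ and $\Gamma^u,\Gamma^r_2;[M]\vdash\Delta^u,\Delta^r_2$ infer $\Gamma^u,\Gamma^r_1,\Gamma^r_2;[P\multimap M]\vdash\Delta^u,\Delta^r_1,\Delta^r_2$. $\Gamma;\hat P\vdash\cdot;\Delta\Rightarrow\Gamma;[?_z\hat P]\vdash\Delta$ provided $z\le x$ for all $x{:}A$ in $\Gamma,\Delta$. (No rule for $\top$.) - Right active: $\Gamma;\Omega\vdash\Xi;\Delta,\mathsf w{:}a\Rightarrow\Gamma;\Omega\vdash\Xi,a;\Delta$. $\Gamma;\Omega\vdash\Xi,N;\Delta$ and $\Gamma;\Omega\vdash\Xi,M;\Delta\Rightarrow\Gamma;\Omega\vdash\Xi,N\& M;\Delta$. $\Rightarrow\Gamma;\Omega\vdash\Xi,\top;\Delta$. $\Gamma;\Omega\vdash\Xi,N,M;\Delta\Rightarrow\Gamma;\Omega\vdash\Xi,N⅋ M;\Delta$. $\Gamma;\Omega\vdash\Xi;\Delta\Rightarrow\Gamma;\Omega\vdash\Xi,\bot;\Delta$.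 $\Gamma;\Omega,P\vdash\Xi,N;\Delta\Rightarrow\Gamma;\Omega\vdash\Xi,P\multimap N;\Delta$. $\Gamma;\Omega\vdash\Xi;\Delta,z{:}\hat P\Rightarrow\Gamma;\Omega\vdash\Xi,?_z\hat P;\Delta$. - Left active: $\Gamma,\mathsf w{:}a;\Omega\vdash\Xi;\Delta\Rightarrow\Gamma;\Omega,a\vdash\Xi;\Delta$. $\Gamma;\Omega,P,Q\vdash\Xi;\Delta\Rightarrow\Gamma;\Omega,P\otimes Q\vdash\Xi;\Delta$. $\Gamma;\Omega\vdash\Xi;\Delta\Rightarrow\Gamma;\Omega,1\vdash\Xi;\Delta$. $\Gamma;\Omega,P\vdash\Xi;\Delta$ and $\Gamma;\Omega,Q\vdash\Xi;\Delta\Rightarrow\Gamma;\Omega,P\oplus Q\vdash\Xi;\Delta$. $\Rightarrow\Gamma;\Omega,0\vdash\Xi;\Delta$. $\Gamma,z{:}\check N;\Omega\vdash\Xi;\Delta\Rightarrow\Gamma;\Omega,!_z\check N\vdash\Xi;\Delta$. - Decision ($P$ positive, $N$ negative): $\Gamma\vdash[P];\Delta\Rightarrow\Gamma;\cdot\vdash\cdot;\Delta,r{:}P$. $\Gamma\vdash[P];\Delta,u{:}P\Rightarrow\Gamma;\cdot\vdash\cdot;\Delta,u{:}P$. $\Gamma;[N]\vdash\Delta\Rightarrow\Gamma,r{:}N;\cdot\vdash\cdot;\Delta$. $\Gamma,u{:}N;[N]\vdash\Delta\Rightarrow\Gamma,u{:}N;\cdot\vdash\cdot;\Delta$. **Focused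 calculus $\mathrm{ISL}(\Sigma)$.** The restriction of the focused calculus $\mathrm{CSL}(\Sigma)$ to intuitionistic formulas and to exactly one formula on the right. Sequents: $\Gamma\vdash[P]$; $\Gamma;[N]\vdash z{:}\hat Q$; $\Gamma;\Omega\vdash\check N;\cdot$; $\Gamma;\Omega\vdash\cdot;z{:}\hat Q$. Its rules are those of $\mathrm{CSL}(\Sigma)$ for the remaining connectives with right contexts restricted accordingly: in right-focus rules the right passive context is empty (so the side condition of the $!_z$ rule concerns only $\Gamma$); in the left-focus rule for $P\multimap M$ the right formula $z{:}\hat Q$ goes to the premise focused on $M$; the side condition of the $?_z$ left-focus rule concerns $\Gamma$ and the zone of the right formula; the initial left-focus rule is $\Rightarrow\Gamma^u;[n]\vdash z{:}n$; the two right decision rules become the single rule $\Gamma\vdash[P]\Rightarrow\Gamma;\cdot\vdash\cdot;z{:}P$ for every zone $z$, with no copying. **Synthetic derivations.** A neutral sequent is one of the form $\Gamma;\cdot\vdash\cdot;\Delta$ (intuitionistically $\Gamma;\cdot\vdash\cdot;z{:}\hat Q$). A synthetic derivation with conclusion a neutral sequent $S$ is a finite derivation with root $S$ whose last rule is a decision rule, with no other decision rule, and all of whose open leaves (its open premises) are neutral sequents. Two synthetic derivations are identified if they differ only in the (inessential) way the active rules are applied, e.g. their order. **Split form.** For $\Sigma=\langle Z,\le,\mathsf w,U\rangle$, its split form is $\hat\Sigma=\langle\hat Z,\hat\le,\hat{\mathsf w},\hat U\rangle$, where, for two distinct labels $\mathsf l,\mathsf r$: $\hat Z=(Z\times\{\mathsf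 l\})\cup(Z\times\{\mathsf r\})$; $\hat U=U\times\{\mathsf l\}$; $\hat{\mathsf w}=(\mathsf w,\mathsf l)$; and $\hat\le$ is the smallest preorder on $\hat Z$ such that $(x,\mathsf l)\,\hat\le\,(y,\mathsf l)$ and $(x,\mathsf r)\,\hat\le\,(y,\mathsf r)$ whenever $x\le y$, and $(x,\mathsf r)\,\hat\le\,(x,\mathsf l)$ for all $x$ (so that $(x,\mathsf l)\,\hat{\not\le}\,(x,\mathsf r)$). **The encoding.** Atoms of source and target are the same. Six mutually recursive translations of intuitionistic formulas over $\Sigma$ into classical formulas over $\hat\Sigma$: - left passive: $(z{:}\check N)^{\mathsf{lp}}=(z,\mathsf l){:}\check N^{\mathsf{lp}}$, with $p^{\mathsf{lp}}=p$ and $N^{\mathsf{lp}}=N^{\mathsf{lf}}$; - left focus: $n^{\mathsf{lf}}=n$, $(?_z\hat P)^{\mathsf{lf}}=\,?_{(z,\mathsf r)}\hat P^{\mathsf{la}}$, $(N\& M)^{\mathsf{lf}}=N^{\mathsf{lf}}\& M^{\mathsf{lf}}$, $\top^{\mathsf{lf}}=\top$, $(P\multimap N)^{\mathsf{lf}}=P^{\mathsf{rf}}\multimap N^{\mathsf{lf}}$; - right focus: $p^{\mathsf{rf}}=p$, $(!_z\check N)^{\mathsf{rf}}=\,!_{(z,\mathsf l)}\check N^{\mathsf{ra}}$, $(P\otimes Q)^{\mathsf{rf}}=P^{\mathsf{rf}}\otimes Q^{\mathsf{rf}}$, $1^{\mathsf{rf}}=1$, $(P\oplus Q)^{\mathsf{rf}}=P^{\mathsf{rf}}\oplus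 Q^{\mathsf{rf}}$, $0^{\mathsf{rf}}=0$; - left active: $a^{\mathsf{la}}=\,!_{(\mathsf w,\mathsf l)}a$, $(!_z\check N)^{\mathsf{la}}=\,!_{(z,\mathsf l)}\check N^{\mathsf{lp}}$, $(P\otimes Q)^{\mathsf{la}}=P^{\mathsf{la}}\otimes Q^{\mathsf{la}}$, $1^{\mathsf{la}}=1$, $(P\oplus Q)^{\mathsf{la}}=P^{\mathsf{la}}\oplus Q^{\mathsf{la}}$, $0^{\mathsf{la}}=0$; - right active: $a^{\mathsf{ra}}=\,?_{(\mathsf w,\mathsf r)}a$, $(?_z\hat P)^{\mathsf{ra}}=\,?_{(z,\mathsf r)}\hat P^{\mathsf{rp}}$, $(N\& M)^{\mathsf{ra}}=N^{\mathsf{ra}}\& M^{\mathsf{ra}}$, $\top^{\mathsf{ra}}=\top$, $(P\multimap N)^{\mathsf{ra}}=P^{\mathsf{la}}\multimap N^{\mathsf{ra}}$; - right passive: $(z{:}\hat P)^{\mathsf{rp}}=(z,\mathsf r){:}\hat P^{\mathsf{rp}}$, with $n^{\mathsf{rp}}=n$ and $P^{\mathsf{rp}}=P^{\mathsf{rf}}$. Contexts are translated elementwise. On sequents: $E(\Gamma\vdash[P])=\Gamma^{\mathsf{lp}}\vdash[P^{\mathsf{rf}}];\cdot$; $E(\Gamma;[N]\vdash z{:}\hat Q)=\Gamma^{\mathsf{lp}};[N^{\mathsf{lf}}]\vdash(z{:}\hat Q)^{\mathsf{rp}}$; $E(\Gamma;\Omega\vdash\check N;\cdot)=\Gamma^{\mathsf{lp}};\Omega^{\mathsf{la}}\vdash\check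 N^{\mathsf{ra}};\cdot$; $E(\Gamma;\Omega\vdash\cdot;z{:}\hat Q)=\Gamma^{\mathsf{lp}};\Omega^{\mathsf{la}}\vdash\cdot;(z{:}\hat Q)^{\mathsf{rp}}$. -}

module Defs where

open import Data.Empty using (⊥)
open import Data.List.Base using (List; []; _∷_; _++_; map)
open import Data.List.Relation.Binary.Permutation.Propositional
  using (_↭_; ↭-refl; ↭-sym; ↭-trans)
import Data.List.Relation.Binary.Permutation.Setoid as SetoidPermutation
open import Data.List.Relation.Binary.Permutation.Setoid.Properties using (++⁺)
open import Data.List.Relation.Unary.All using (All; []; _∷_)
open import Data.Product.Base using (∃; _×_; _,_; proj₁; proj₂)
open import Data.Unit.Base using (⊤)
open import Function.Base using (_∘_)
open import Level using (0ℓ)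
open import Relation.Binary.Bundles using (Setoid)
open import Relation.Binary.Construct.Closure.ReflexiveTransitive using (Star; ε; _◅_)
import Relation.Binary.Construct.Closure.ReflexiveTransitive.Properties as Star
import Relation.Binary.Construct.On as On
open import Relation.Binary.Core using (Rel)
open import Relation.Binary.Definitions using (_Respects_)
open import Relation.Binary.PropositionalEquality using (_≡_; _≢_; refl; sym; trans)
open import Relation.Binary.Structures using (IsEquivalence; IsPreorder)
open import Relation.Nullary using (¬_)
open import Relation.Unary using (Pred)

record Signature : Set₁ where
  field
    Zone       : Set
    _≤_        : Rel Zone 0ℓ
    isPreorder : IsPreorder _≡_ _≤_
    𝗐          : Zone
    U          : Pred Zone 0ℓ
    U-upward   : U Respects _≤_

data Side : Set where
  𝗅 𝗋 : Side

module SplitForm (Sig : Signature) where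
  open Signature Sig

  data _⊏_ : Rel (Zone × Side) 0ℓ where
    left       : ∀ {x y} → x ≤ y → (x , 𝗅) ⊏ (y , 𝗅)
    right      : ∀ {x y} → x ≤ y → (x , 𝗋) ⊏ (y , 𝗋)
    right-left : ∀ {x} → (x , 𝗋) ⊏ (x , 𝗅)

  Û : Pred (Zone × Side) 0ℓ
  Û (z , 𝗅) = U z
  Û (z , 𝗋) = ⊥

  Û-upward : Û Respects Star _⊏_
  Û-upward ε                  u = u
  Û-upward (left x≤y ◅ y≤z)   u = Û-upward y≤z (U-upward x≤y u)

  split : Signature
  split = record
    { Zone       = Zone × Side
    ; _≤_        = Star _⊏_
    ; isPreorder = Star.isPreorder _⊏_
    ; 𝗐          = 𝗐 , 𝗅
    ; U          = Û
    ; U-upward   = Û-upward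
    }

open SplitForm public using (split)

record Atoms : Set₁ where
  field
    Positive Negative : Set

data Logic : Set where
  classical intuitionistic : Logic

module Formulas (𝔸 : Atoms) (Zone : Set) where
  open Atoms 𝔸

  infixr 7 _⊗_ _&_ _⅋_
  infixr 6 _⊕_
  infixr 5 _⊸_

  -- Hat is the class P̂ and Check the class Ň.
  mutual
    data Pos : Logic → Set where
      atom⁺ : ∀ {L} → Positive → Pos L
      _⊗_   : ∀ {L} → Pos L → Pos L → Pos L
      𝟏     : ∀ {L} → Pos L
      _⊕_   : ∀ {L} → Pos L → Pos L → Pos L
      𝟎     : ∀ {L} → Pos L
      !⟨_⟩_ : ∀ {L} → Zone → Check L → Pos L

    data Neg : Logic → Set where
      atom⁻ : ∀ {L} → Negative → Neg L
      _&_   : ∀ {L} → Neg L → Neg L → Neg L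
      ⊤⁻    : ∀ {L} → Neg L
      _⅋_   : Neg classical → Neg classical → Neg classical
      ⊥⁻    : Neg classical
      _⊸_   : ∀ {L} → Pos L → Neg L → Neg L
      ?⟨_⟩_ : ∀ {L} → Zone → Hat L → Neg L

    data Hat : Logic → Set where
      pos   : ∀ {L} → Pos L → Hat L
      atom⁻ : ∀ {L} → Negative → Hat L

    data Check : Logic → Set where
      neg   : ∀ {L} → Neg L → Check L
      atom⁺ : ∀ {L} → Positive → Check L

infix 6 _⦂_
pattern _⦂_ z A = z , A

-- Contexts are lists whose positions serve as occurrences: rules act at
-- arbitrary positions, and sequents are compared up to permutation.

-- Remove x xs ys: deleting one occurrence of x from xs leaves ys.
data Remove {A : Set} (x : A) : List A → List A → Set where
  here  : ∀ {xs} → Remove x (x ∷ xs) xs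
  there : ∀ {y xs ys} → Remove x xs ys → Remove x (y ∷ xs) (y ∷ ys)

-- Split R xs ys zs: xs is Γᵘ,Γʳ₁,Γʳ₂ with ys = Γᵘ,Γʳ₁ and zs = Γᵘ,Γʳ₂, where R
-- holds of the unrestricted elements.  Here and in the rules below, side
-- conditions are irrelevant arguments, so that derivations are not
-- distinguished by the evidence given for them.
data Split {A : Set} (R : A → Set) : List A → List A → List A → Set where
  []     : Split R [] [] []
  shared : ∀ {x xs ys zs} → .(R x)   → Split R xs ys zs → Split R (x ∷ xs) (x ∷ ys) (x ∷ zs)
  first  : ∀ {x xs ys zs} → .(¬ R x) → Split R xs ys zs → Split R (x ∷ xs) (x ∷ ys) zs
  second : ∀ {x xs ys zs} → .(¬ R x) → Split R xs ys zs → Split R (x ∷ xs) ys (x ∷ zs)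

data Kind : Set where
  decision focus active : Kind

record Calculus : Set₁ where
  field
    Sequent         : Set
    _≋_             : Rel Sequent 0ℓ
    ≋-isEquivalence : IsEquivalence _≋_
    Neutral         : Sequent → Set
    -- Rule k premises conclusion
    Rule            : Kind → List Sequent → Sequent → Set

module Derivations (C : Calculus) where
  open Calculus C

  sequents : Setoid 0ℓ 0ℓ
  sequents = record { isEquivalence = ≋-isEquivalence }

  private module ↭ˢ = SetoidPermutation sequents

  infix 4 _↭ˢ_
  _↭ˢ_ : Rel (List Sequent) 0ℓ
  _↭ˢ_ = ↭ˢ._↭_

  data Derivation (S : Sequent) : Set where
    leaf  : Derivation S
    infer : ∀ {k Ss} → Rule k Ss S → All Derivation Ss → Derivation S

  mutual
    leaves : ∀ {S} → Derivation S → List Sequent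
    leaves {S} leaf     = S ∷ []
    leaves (infer r ds) = leaves* ds

    leaves* : ∀ {Ss} → All Derivation Ss → List Sequent
    leaves* []       = []
    leaves* (d ∷ ds) = leaves d ++ leaves* ds

  mutual
    DecisionFree : ∀ {S} → Derivation S → Set
    DecisionFree leaf             = ⊤
    DecisionFree (infer {k} r ds) = k ≢ decision × DecisionFree* ds

    DecisionFree* : ∀ {Ss} → All Derivation Ss → Set
    DecisionFree* []       = ⊤
    DecisionFree* (d ∷ ds) = DecisionFree d × DecisionFree* ds

  IsSynthetic : ∀ {S} → Derivation S → Set
  IsSynthetic leaf             = ⊥
  IsSynthetic (infer {k} r ds) = k ≡ decision × DecisionFree* ds × All Neutral (leaves* ds)

  Synthetic : Sequent → Set
  Synthetic S = ∃ (IsSynthetic {S})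

  openPremises : ∀ {S} → Synthetic S → List Sequent
  openPremises d = leaves (proj₁ d)

  -- The identification of derivations differing only in how the active rules
  -- are applied.  In a synthetic derivation only active rules occur above an
  -- active rule, so the derivations compared by `active` are two complete
  -- active phases from the same sequent; they must have the same multiset of
  -- open premises.
  infix 4 _≈_ _≈*_
  mutual
    data _≈_ {S} : Rel (Derivation S) 0ℓ where
      leaf   : leaf ≈ leaf
      infer  : ∀ {k Ss} (r : Rule k Ss S) {ds es} → ds ≈* es → infer r ds ≈ infer r es
      active : ∀ {Ss Ts} {r : Rule active Ss S} {r′ : Rule active Ts S} {ds es} →
               leaves* ds ↭ˢ leaves* es → infer r ds ≈ infer r′ es

    data _≈*_ : ∀ {Ss} → Rel (All Derivation Ss) 0ℓ where
      []  : [] ≈* []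
      _∷_ : ∀ {S Ss} {d e : Derivation S} {ds es : All Derivation Ss} →
            d ≈ e → ds ≈* es → (d ∷ ds) ≈* (e ∷ es)

  mutual
    ≈-refl : ∀ {S} {d : Derivation S} → d ≈ d
    ≈-refl {d = leaf}       = leaf
    ≈-refl {d = infer r ds} = infer r ≈*-refl

    ≈*-refl : ∀ {Ss} {ds : All Derivation Ss} → ds ≈* ds
    ≈*-refl {ds = []}     = []
    ≈*-refl {ds = d ∷ ds} = ≈-refl ∷ ≈*-refl

  mutual
    ≈-sym : ∀ {S} {d e : Derivation S} → d ≈ e → e ≈ d
    ≈-sym leaf        = leaf
    ≈-sym (infer r p) = infer r (≈*-sym p)
    ≈-sym (active p)  = active (↭ˢ.↭-sym p)

    ≈*-sym : ∀ {Ss} {ds es : All Derivation Ss} → ds ≈* es → es ≈* ds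
    ≈*-sym []       = []
    ≈*-sym (p ∷ ps) = ≈-sym p ∷ ≈*-sym ps

  mutual
    ≈⇒↭ˢ : ∀ {S} {d e : Derivation S} → d ≈ e → leaves d ↭ˢ leaves e
    ≈⇒↭ˢ leaf        = ↭ˢ.↭-refl
    ≈⇒↭ˢ (infer r p) = ≈*⇒↭ˢ p
    ≈⇒↭ˢ (active p)  = p

    ≈*⇒↭ˢ : ∀ {Ss} {ds es : All Derivation Ss} → ds ≈* es → leaves* ds ↭ˢ leaves* es
    ≈*⇒↭ˢ []       = ↭ˢ.↭-refl
    ≈*⇒↭ˢ (p ∷ ps) = ++⁺ sequents (≈⇒↭ˢ p) (≈*⇒↭ˢ ps)

  mutual
    ≈-trans : ∀ {S} {d e f : Derivation S} → d ≈ e → e ≈ f → d ≈ f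
    ≈-trans leaf        q           = q
    ≈-trans (infer r p) (infer .r q) = infer r (≈*-trans p q)
    ≈-trans (infer r p) (active q)  = active (↭ˢ.↭-trans (≈*⇒↭ˢ p) q)
    ≈-trans (active p)  (infer r q) = active (↭ˢ.↭-trans p (≈*⇒↭ˢ q))
    ≈-trans (active p)  (active q)  = active (↭ˢ.↭-trans p q)

    ≈*-trans : ∀ {Ss} {ds es fs : All Derivation Ss} → ds ≈* es → es ≈* fs → ds ≈* fs
    ≈*-trans []       []       = []
    ≈*-trans (p ∷ ps) (q ∷ qs) = ≈-trans p q ∷ ≈*-trans ps qs

  derivations : Sequent → Setoid 0ℓ 0ℓ
  derivations S = record
    { Carrier       = Derivation S
    ; _≈_           = _≈_
    ; isEquivalence = record { refl = ≈-refl ; sym = ≈-sym ; trans = ≈-trans }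
    }

  synthetic : Sequent → Setoid 0ℓ 0ℓ
  synthetic S = On.setoid {B = Synthetic S} (derivations S) proj₁

module CSL (𝔸 : Atoms) (Sig : Signature) where
  open Signature Sig
  open Formulas 𝔸 Zone public

  P̂ Ň : Set
  P̂ = Hat classical
  Ň = Check classical

  Unrestricted : ∀ {A : Set} → Zone × A → Set
  Unrestricted = U ∘ proj₁

  infix 4 _≼_
  _≼_ : ∀ {A : Set} → Zone → List (Zone × A) → Set
  z ≼ Γ = All (λ x → z ≤ proj₁ x) Γ

  infix 3 _⊢[_]⨟_ _⨟[_]⊢_ _⨟_⊢_⨟_
  data Sequent : Set where
    _⊢[_]⨟_ : List (Zone × Ň) → Pos classical → List (Zone × P̂) → Sequent
    _⨟[_]⊢_ : List (Zone × Ň) → Neg classical → List (Zone × P̂) → Sequent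
    _⨟_⊢_⨟_ : List (Zone × Ň) → List P̂ → List Ň → List (Zone × P̂) → Sequent

  infix 2 _≋_
  data _≋_ : Rel Sequent 0ℓ where
    right-focus : ∀ {Γ Γ′ P Δ Δ′} → Γ ↭ Γ′ → Δ ↭ Δ′ → Γ ⊢[ P ]⨟ Δ ≋ Γ′ ⊢[ P ]⨟ Δ′
    left-focus  : ∀ {Γ Γ′ N Δ Δ′} → Γ ↭ Γ′ → Δ ↭ Δ′ → Γ ⨟[ N ]⊢ Δ ≋ Γ′ ⨟[ N ]⊢ Δ′
    active      : ∀ {Γ Γ′ Ω Ω′ Ξ Ξ′ Δ Δ′} → Γ ↭ Γ′ → Ω ↭ Ω′ → Ξ ↭ Ξ′ → Δ ↭ Δ′ →
                  Γ ⨟ Ω ⊢ Ξ ⨟ Δ ≋ Γ′ ⨟ Ω′ ⊢ Ξ′ ⨟ Δ′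

  ≋-isEquivalence : IsEquivalence _≋_
  ≋-isEquivalence = record
    { refl  = λ { {Γ ⊢[ P ]⨟ Δ} → right-focus ↭-refl ↭-refl
                ; {Γ ⨟[ N ]⊢ Δ} → left-focus ↭-refl ↭-refl
                ; {Γ ⨟ Ω ⊢ Ξ ⨟ Δ} → active ↭-refl ↭-refl ↭-refl ↭-refl }
    ; sym   = λ { (right-focus p q) → right-focus (↭-sym p) (↭-sym q)
                ; (left-focus p q) → left-focus (↭-sym p) (↭-sym q)
                ; (active p q r s) → active (↭-sym p) (↭-sym q) (↭-sym r) (↭-sym s) }
    ; trans = λ { (right-focus p q) (right-focus p′ q′) →
                    right-focus (↭-trans p p′) (↭-trans q q′)
                ; (left-focus p q) (left-focus p′ q′) →
                    left-focus (↭-trans p p′) (↭-trans q q′)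
                ; (active p q r s) (active p′ q′ r′ s′) →
                    active (↭-trans p p′) (↭-trans q q′) (↭-trans r r′) (↭-trans s s′) }
    }

  data Neutral : Sequent → Set where
    neutral : ∀ {Γ Δ} → Neutral (Γ ⨟ [] ⊢ [] ⨟ Δ)

  data Rule : Kind → List Sequent → Sequent → Set where

    init⁺ : ∀ {Γ Γᵘ z p Δᵘ} → Remove (z ⦂ atom⁺ p) Γ Γᵘ →
            .(All Unrestricted Γᵘ) → .(All Unrestricted Δᵘ) →
            Rule focus [] (Γ ⊢[ atom⁺ p ]⨟ Δᵘ)
    ⊗R    : ∀ {Γ Γ₁ Γ₂ P Q Δ Δ₁ Δ₂} → Split Unrestricted Γ Γ₁ Γ₂ → Split Unrestricted Δ Δ₁ Δ₂ →
            Rule focus ((Γ₁ ⊢[ P ]⨟ Δ₁) ∷ (Γ₂ ⊢[ Q ]⨟ Δ₂) ∷ []) (Γ ⊢[ P ⊗ Q ]⨟ Δ)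
    𝟏R    : ∀ {Γᵘ Δᵘ} → .(All Unrestricted Γᵘ) → .(All Unrestricted Δᵘ) →
            Rule focus [] (Γᵘ ⊢[ 𝟏 ]⨟ Δᵘ)
    ⊕R₁   : ∀ {Γ P₁ P₂ Δ} → Rule focus ((Γ ⊢[ P₁ ]⨟ Δ) ∷ []) (Γ ⊢[ P₁ ⊕ P₂ ]⨟ Δ)
    ⊕R₂   : ∀ {Γ P₁ P₂ Δ} → Rule focus ((Γ ⊢[ P₂ ]⨟ Δ) ∷ []) (Γ ⊢[ P₁ ⊕ P₂ ]⨟ Δ)
    !R    : ∀ {Γ z A Δ} → .(z ≼ Γ) → .(z ≼ Δ) →
            Rule focus ((Γ ⨟ [] ⊢ A ∷ [] ⨟ Δ) ∷ []) (Γ ⊢[ !⟨ z ⟩ A ]⨟ Δ)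

    init⁻ : ∀ {Γᵘ n z Δ Δᵘ} → Remove (z ⦂ atom⁻ n) Δ Δᵘ →
            .(All Unrestricted Γᵘ) → .(All Unrestricted Δᵘ) →
            Rule focus [] (Γᵘ ⨟[ atom⁻ n ]⊢ Δ)
    &L₁   : ∀ {Γ N₁ N₂ Δ} → Rule focus ((Γ ⨟[ N₁ ]⊢ Δ) ∷ []) (Γ ⨟[ N₁ & N₂ ]⊢ Δ)
    &L₂   : ∀ {Γ N₁ N₂ Δ} → Rule focus ((Γ ⨟[ N₂ ]⊢ Δ) ∷ []) (Γ ⨟[ N₁ & N₂ ]⊢ Δ)
    ⅋L    : ∀ {Γ Γ₁ Γ₂ N M Δ Δ₁ Δ₂} → Split Unrestricted Γ Γ₁ Γ₂ → Split Unrestricted Δ Δ₁ Δ₂ →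
            Rule focus ((Γ₁ ⨟[ N ]⊢ Δ₁) ∷ (Γ₂ ⨟[ M ]⊢ Δ₂) ∷ []) (Γ ⨟[ N ⅋ M ]⊢ Δ)
    ⊥L    : ∀ {Γᵘ Δᵘ} → .(All Unrestricted Γᵘ) → .(All Unrestricted Δᵘ) →
            Rule focus [] (Γᵘ ⨟[ ⊥⁻ ]⊢ Δᵘ)
    ⊸L    : ∀ {Γ Γ₁ Γ₂ P M Δ Δ₁ Δ₂} → Split Unrestricted Γ Γ₁ Γ₂ → Split Unrestricted Δ Δ₁ Δ₂ →
            Rule focus ((Γ₁ ⊢[ P ]⨟ Δ₁) ∷ (Γ₂ ⨟[ M ]⊢ Δ₂) ∷ []) (Γ ⨟[ P ⊸ M ]⊢ Δ)
    ?L    : ∀ {Γ z A Δ} → .(z ≼ Γ) → .(z ≼ Δ) →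
            Rule focus ((Γ ⨟ A ∷ [] ⊢ [] ⨟ Δ) ∷ []) (Γ ⨟[ ?⟨ z ⟩ A ]⊢ Δ)

    atom⁺R : ∀ {Γ Ω Ξ Ξ′ Δ p} → Remove (atom⁺ p) Ξ Ξ′ →
             Rule active ((Γ ⨟ Ω ⊢ Ξ′ ⨟ (𝗐 ⦂ pos (atom⁺ p)) ∷ Δ) ∷ []) (Γ ⨟ Ω ⊢ Ξ ⨟ Δ)
    atom⁻R : ∀ {Γ Ω Ξ Ξ′ Δ n} → Remove (neg (atom⁻ n)) Ξ Ξ′ →
             Rule active ((Γ ⨟ Ω ⊢ Ξ′ ⨟ (𝗐 ⦂ atom⁻ n) ∷ Δ) ∷ []) (Γ ⨟ Ω ⊢ Ξ ⨟ Δ)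
    &R     : ∀ {Γ Ω Ξ Ξ′ Δ N M} → Remove (neg (N & M)) Ξ Ξ′ →
             Rule active ((Γ ⨟ Ω ⊢ neg N ∷ Ξ′ ⨟ Δ) ∷ (Γ ⨟ Ω ⊢ neg M ∷ Ξ′ ⨟ Δ) ∷ []) (Γ ⨟ Ω ⊢ Ξ ⨟ Δ)
    ⊤R     : ∀ {Γ Ω Ξ Ξ′ Δ} → Remove (neg ⊤⁻) Ξ Ξ′ →
             Rule active [] (Γ ⨟ Ω ⊢ Ξ ⨟ Δ)
    ⅋R     : ∀ {Γ Ω Ξ Ξ′ Δ N M} → Remove (neg (N ⅋ M)) Ξ Ξ′ →
             Rule active ((Γ ⨟ Ω ⊢ neg N ∷ neg M ∷ Ξ′ ⨟ Δ) ∷ []) (Γ ⨟ Ω ⊢ Ξ ⨟ Δ)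
    ⊥R     : ∀ {Γ Ω Ξ Ξ′ Δ} → Remove (neg ⊥⁻) Ξ Ξ′ →
             Rule active ((Γ ⨟ Ω ⊢ Ξ′ ⨟ Δ) ∷ []) (Γ ⨟ Ω ⊢ Ξ ⨟ Δ)
    ⊸R     : ∀ {Γ Ω Ξ Ξ′ Δ P N} → Remove (neg (P ⊸ N)) Ξ Ξ′ →
             Rule active ((Γ ⨟ pos P ∷ Ω ⊢ neg N ∷ Ξ′ ⨟ Δ) ∷ []) (Γ ⨟ Ω ⊢ Ξ ⨟ Δ)
    ?R     : ∀ {Γ Ω Ξ Ξ′ Δ z A} → Remove (neg (?⟨ z ⟩ A)) Ξ Ξ′ →
             Rule active ((Γ ⨟ Ω ⊢ Ξ′ ⨟ (z ⦂ A) ∷ Δ) ∷ []) (Γ ⨟ Ω ⊢ Ξ ⨟ Δ)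

    atom⁺L : ∀ {Γ Ω Ω′ Ξ Δ p} → Remove (pos (atom⁺ p)) Ω Ω′ →
             Rule active (((𝗐 ⦂ atom⁺ p) ∷ Γ ⨟ Ω′ ⊢ Ξ ⨟ Δ) ∷ []) (Γ ⨟ Ω ⊢ Ξ ⨟ Δ)
    atom⁻L : ∀ {Γ Ω Ω′ Ξ Δ n} → Remove (atom⁻ n) Ω Ω′ →
             Rule active (((𝗐 ⦂ neg (atom⁻ n)) ∷ Γ ⨟ Ω′ ⊢ Ξ ⨟ Δ) ∷ []) (Γ ⨟ Ω ⊢ Ξ ⨟ Δ)
    ⊗L     : ∀ {Γ Ω Ω′ Ξ Δ P Q} → Remove (pos (P ⊗ Q)) Ω Ω′ →
             Rule active ((Γ ⨟ pos P ∷ pos Q ∷ Ω′ ⊢ Ξ ⨟ Δ) ∷ []) (Γ ⨟ Ω ⊢ Ξ ⨟ Δ)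
    𝟏L     : ∀ {Γ Ω Ω′ Ξ Δ} → Remove (pos 𝟏) Ω Ω′ →
             Rule active ((Γ ⨟ Ω′ ⊢ Ξ ⨟ Δ) ∷ []) (Γ ⨟ Ω ⊢ Ξ ⨟ Δ)
    ⊕L     : ∀ {Γ Ω Ω′ Ξ Δ P Q} → Remove (pos (P ⊕ Q)) Ω Ω′ →
             Rule active ((Γ ⨟ pos P ∷ Ω′ ⊢ Ξ ⨟ Δ) ∷ (Γ ⨟ pos Q ∷ Ω′ ⊢ Ξ ⨟ Δ) ∷ []) (Γ ⨟ Ω ⊢ Ξ ⨟ Δ)
    𝟎L     : ∀ {Γ Ω Ω′ Ξ Δ} → Remove (pos 𝟎) Ω Ω′ →
             Rule active [] (Γ ⨟ Ω ⊢ Ξ ⨟ Δ)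
    !L     : ∀ {Γ Ω Ω′ Ξ Δ z A} → Remove (pos (!⟨ z ⟩ A)) Ω Ω′ →
             Rule active (((z ⦂ A) ∷ Γ ⨟ Ω′ ⊢ Ξ ⨟ Δ) ∷ []) (Γ ⨟ Ω ⊢ Ξ ⨟ Δ)

    decideRʳ : ∀ {Γ z P Δ Δ′} → Remove (z ⦂ pos P) Δ Δ′ → .(¬ U z) →
               Rule decision ((Γ ⊢[ P ]⨟ Δ′) ∷ []) (Γ ⨟ [] ⊢ [] ⨟ Δ)
    decideRᵘ : ∀ {Γ z P Δ Δ′} → Remove (z ⦂ pos P) Δ Δ′ → .(U z) →
               Rule decision ((Γ ⊢[ P ]⨟ Δ) ∷ []) (Γ ⨟ [] ⊢ [] ⨟ Δ)
    decideLʳ : ∀ {Γ Γ′ z N Δ} → Remove (z ⦂ neg N) Γ Γ′ → .(¬ U z) →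
               Rule decision ((Γ′ ⨟[ N ]⊢ Δ) ∷ []) (Γ ⨟ [] ⊢ [] ⨟ Δ)
    decideLᵘ : ∀ {Γ Γ′ z N Δ} → Remove (z ⦂ neg N) Γ Γ′ → .(U z) →
               Rule decision ((Γ ⨟[ N ]⊢ Δ) ∷ []) (Γ ⨟ [] ⊢ [] ⨟ Δ)

  calculus : Calculus
  calculus = record
    { Sequent = Sequent ; _≋_ = _≋_ ; ≋-isEquivalence = ≋-isEquivalence
    ; Neutral = Neutral ; Rule = Rule }

  open Derivations calculus public

module ISL (𝔸 : Atoms) (Sig : Signature) where
  open Signature Sig
  open Formulas 𝔸 Zone public

  P̂ Ň : Set
  P̂ = Hat intuitionistic
  Ň = Check intuitionistic

  Unrestricted : ∀ {A : Set} → Zone × A → Set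
  Unrestricted = U ∘ proj₁

  infix 4 _≼_
  _≼_ : ∀ {A : Set} → Zone → List (Zone × A) → Set
  z ≼ Γ = All (λ x → z ≤ proj₁ x) Γ

  -- The right-hand side of an active sequent: `Ň ⨟·` or `·⨟ z ⦂ P̂`.
  infix 5 _⨟· ·⨟_
  data Right : Set where
    _⨟· : Ň → Right
    ·⨟_ : Zone × P̂ → Right

  infix 3 _⊢[_] _⨟[_]⊢_ _⨟_⊢_
  data Sequent : Set where
    _⊢[_]   : List (Zone × Ň) → Pos intuitionistic → Sequent
    _⨟[_]⊢_ : List (Zone × Ň) → Neg intuitionistic → Zone × P̂ → Sequent
    _⨟_⊢_   : List (Zone × Ň) → List P̂ → Right → Sequent

  infix 2 _≋_
  data _≋_ : Rel Sequent 0ℓ where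
    right-focus : ∀ {Γ Γ′ P} → Γ ↭ Γ′ → Γ ⊢[ P ] ≋ Γ′ ⊢[ P ]
    left-focus  : ∀ {Γ Γ′ N δ} → Γ ↭ Γ′ → Γ ⨟[ N ]⊢ δ ≋ Γ′ ⨟[ N ]⊢ δ
    active      : ∀ {Γ Γ′ Ω Ω′ ρ} → Γ ↭ Γ′ → Ω ↭ Ω′ → Γ ⨟ Ω ⊢ ρ ≋ Γ′ ⨟ Ω′ ⊢ ρ

  ≋-isEquivalence : IsEquivalence _≋_
  ≋-isEquivalence = record
    { refl  = λ { {Γ ⊢[ P ]} → right-focus ↭-refl
                ; {Γ ⨟[ N ]⊢ δ} → left-focus ↭-refl
                ; {Γ ⨟ Ω ⊢ ρ} → active ↭-refl ↭-refl }
    ; sym   = λ { (right-focus p) → right-focus (↭-sym p)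
                ; (left-focus p) → left-focus (↭-sym p)
                ; (active p q) → active (↭-sym p) (↭-sym q) }
    ; trans = λ { (right-focus p) (right-focus p′) → right-focus (↭-trans p p′)
                ; (left-focus p) (left-focus p′) → left-focus (↭-trans p p′)
                ; (active p q) (active p′ q′) → active (↭-trans p p′) (↭-trans q q′) }
    }

  data Neutral : Sequent → Set where
    neutral : ∀ {Γ δ} → Neutral (Γ ⨟ [] ⊢ ·⨟ δ)

  data Rule : Kind → List Sequent → Sequent → Set where

    init⁺ : ∀ {Γ Γᵘ z p} → Remove (z ⦂ atom⁺ p) Γ Γᵘ → .(All Unrestricted Γᵘ) →
            Rule focus [] (Γ ⊢[ atom⁺ p ])
    ⊗R    : ∀ {Γ Γ₁ Γ₂ P Q} → Split Unrestricted Γ Γ₁ Γ₂ →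
            Rule focus ((Γ₁ ⊢[ P ]) ∷ (Γ₂ ⊢[ Q ]) ∷ []) (Γ ⊢[ P ⊗ Q ])
    𝟏R    : ∀ {Γᵘ} → .(All Unrestricted Γᵘ) →
            Rule focus [] (Γᵘ ⊢[ 𝟏 ])
    ⊕R₁   : ∀ {Γ P₁ P₂} → Rule focus ((Γ ⊢[ P₁ ]) ∷ []) (Γ ⊢[ P₁ ⊕ P₂ ])
    ⊕R₂   : ∀ {Γ P₁ P₂} → Rule focus ((Γ ⊢[ P₂ ]) ∷ []) (Γ ⊢[ P₁ ⊕ P₂ ])
    !R    : ∀ {Γ z A} → .(z ≼ Γ) →
            Rule focus ((Γ ⨟ [] ⊢ A ⨟·) ∷ []) (Γ ⊢[ !⟨ z ⟩ A ])

    init⁻ : ∀ {Γᵘ n z} → .(All Unrestricted Γᵘ) →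
            Rule focus [] (Γᵘ ⨟[ atom⁻ n ]⊢ z ⦂ atom⁻ n)
    &L₁   : ∀ {Γ N₁ N₂ δ} → Rule focus ((Γ ⨟[ N₁ ]⊢ δ) ∷ []) (Γ ⨟[ N₁ & N₂ ]⊢ δ)
    &L₂   : ∀ {Γ N₁ N₂ δ} → Rule focus ((Γ ⨟[ N₂ ]⊢ δ) ∷ []) (Γ ⨟[ N₁ & N₂ ]⊢ δ)
    ⊸L    : ∀ {Γ Γ₁ Γ₂ P M δ} → Split Unrestricted Γ Γ₁ Γ₂ →
            Rule focus ((Γ₁ ⊢[ P ]) ∷ (Γ₂ ⨟[ M ]⊢ δ) ∷ []) (Γ ⨟[ P ⊸ M ]⊢ δ)
    ?L    : ∀ {Γ z A x B} → .(z ≼ Γ) → .(z ≤ x) →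
            Rule focus ((Γ ⨟ A ∷ [] ⊢ ·⨟ x ⦂ B) ∷ []) (Γ ⨟[ ?⟨ z ⟩ A ]⊢ x ⦂ B)

    atom⁺R : ∀ {Γ Ω p} →
             Rule active ((Γ ⨟ Ω ⊢ ·⨟ 𝗐 ⦂ pos (atom⁺ p)) ∷ []) (Γ ⨟ Ω ⊢ atom⁺ p ⨟·)
    atom⁻R : ∀ {Γ Ω n} →
             Rule active ((Γ ⨟ Ω ⊢ ·⨟ 𝗐 ⦂ atom⁻ n) ∷ []) (Γ ⨟ Ω ⊢ neg (atom⁻ n) ⨟·)
    &R     : ∀ {Γ Ω N M} →
             Rule active ((Γ ⨟ Ω ⊢ neg N ⨟·) ∷ (Γ ⨟ Ω ⊢ neg M ⨟·) ∷ []) (Γ ⨟ Ω ⊢ neg (N & M) ⨟·)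
    ⊤R     : ∀ {Γ Ω} → Rule active [] (Γ ⨟ Ω ⊢ neg ⊤⁻ ⨟·)
    ⊸R     : ∀ {Γ Ω P N} →
             Rule active ((Γ ⨟ pos P ∷ Ω ⊢ neg N ⨟·) ∷ []) (Γ ⨟ Ω ⊢ neg (P ⊸ N) ⨟·)
    ?R     : ∀ {Γ Ω z A} →
             Rule active ((Γ ⨟ Ω ⊢ ·⨟ z ⦂ A) ∷ []) (Γ ⨟ Ω ⊢ neg (?⟨ z ⟩ A) ⨟·)

    atom⁺L : ∀ {Γ Ω Ω′ ρ p} → Remove (pos (atom⁺ p)) Ω Ω′ →
             Rule active (((𝗐 ⦂ atom⁺ p) ∷ Γ ⨟ Ω′ ⊢ ρ) ∷ []) (Γ ⨟ Ω ⊢ ρ)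
    atom⁻L : ∀ {Γ Ω Ω′ ρ n} → Remove (atom⁻ n) Ω Ω′ →
             Rule active (((𝗐 ⦂ neg (atom⁻ n)) ∷ Γ ⨟ Ω′ ⊢ ρ) ∷ []) (Γ ⨟ Ω ⊢ ρ)
    ⊗L     : ∀ {Γ Ω Ω′ ρ P Q} → Remove (pos (P ⊗ Q)) Ω Ω′ →
             Rule active ((Γ ⨟ pos P ∷ pos Q ∷ Ω′ ⊢ ρ) ∷ []) (Γ ⨟ Ω ⊢ ρ)
    𝟏L     : ∀ {Γ Ω Ω′ ρ} → Remove (pos 𝟏) Ω Ω′ →
             Rule active ((Γ ⨟ Ω′ ⊢ ρ) ∷ []) (Γ ⨟ Ω ⊢ ρ)
    ⊕L     : ∀ {Γ Ω Ω′ ρ P Q} → Remove (pos (P ⊕ Q)) Ω Ω′ →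
             Rule active ((Γ ⨟ pos P ∷ Ω′ ⊢ ρ) ∷ (Γ ⨟ pos Q ∷ Ω′ ⊢ ρ) ∷ []) (Γ ⨟ Ω ⊢ ρ)
    𝟎L     : ∀ {Γ Ω Ω′ ρ} → Remove (pos 𝟎) Ω Ω′ →
             Rule active [] (Γ ⨟ Ω ⊢ ρ)
    !L     : ∀ {Γ Ω Ω′ ρ z A} → Remove (pos (!⟨ z ⟩ A)) Ω Ω′ →
             Rule active (((z ⦂ A) ∷ Γ ⨟ Ω′ ⊢ ρ) ∷ []) (Γ ⨟ Ω ⊢ ρ)

    decideR  : ∀ {Γ z P} →
               Rule decision ((Γ ⊢[ P ]) ∷ []) (Γ ⨟ [] ⊢ ·⨟ z ⦂ pos P)
    decideLʳ : ∀ {Γ Γ′ z N δ} → Remove (z ⦂ neg N) Γ Γ′ → .(¬ U z) →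
               Rule decision ((Γ′ ⨟[ N ]⊢ δ) ∷ []) (Γ ⨟ [] ⊢ ·⨟ δ)
    decideLᵘ : ∀ {Γ Γ′ z N δ} → Remove (z ⦂ neg N) Γ Γ′ → .(U z) →
               Rule decision ((Γ ⨟[ N ]⊢ δ) ∷ []) (Γ ⨟ [] ⊢ ·⨟ δ)

  calculus : Calculus
  calculus = record
    { Sequent = Sequent ; _≋_ = _≋_ ; ≋-isEquivalence = ≋-isEquivalence
    ; Neutral = Neutral ; Rule = Rule }

  open Derivations calculus public

module Encoding (𝔸 : Atoms) (Sig : Signature) where
  open Signature Sig
  private
    module I = ISL 𝔸 Sig
    module C = CSL 𝔸 (split Sig)
  open I using (atom⁺; atom⁻; _⊗_; 𝟏; _⊕_; 𝟎; !⟨_⟩_; _&_; ⊤⁻; _⊸_; ?⟨_⟩_; pos; neg;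
                _⨟·; ·⨟_; _⊢[_]; _⨟[_]⊢_; _⨟_⊢_)
  open C using (_⊢[_]⨟_; _⨟_⊢_⨟_)

  -- The superscripts ʰ and ᶜ mark the action on the classes P̂ and Ň.
  mutual
    lpᶜ : I.Ň → C.Ň
    lpᶜ (atom⁺ p) = C.atom⁺ p
    lpᶜ (neg N)   = C.neg (lf N)

    lf : I.Neg intuitionistic → C.Neg classical
    lf (atom⁻ n)   = C.atom⁻ n
    lf (?⟨ z ⟩ A)  = C.?⟨ z , 𝗋 ⟩ C.pos (laʰ A)
    lf (N & M)     = lf N C.& lf M
    lf ⊤⁻          = C.⊤⁻
    lf (P ⊸ N)     = rf P C.⊸ lf N

    rf : I.Pos intuitionistic → C.Pos classical
    rf (atom⁺ p)   = C.atom⁺ p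
    rf (!⟨ z ⟩ A)  = C.!⟨ z , 𝗅 ⟩ C.neg (raᶜ A)
    rf (P ⊗ Q)     = rf P C.⊗ rf Q
    rf 𝟏           = C.𝟏
    rf (P ⊕ Q)     = rf P C.⊕ rf Q
    rf 𝟎           = C.𝟎

    laʰ : I.P̂ → C.Pos classical
    laʰ (atom⁻ n) = C.!⟨ 𝗐 , 𝗅 ⟩ C.neg (C.atom⁻ n)
    laʰ (pos P)   = la P

    la : I.Pos intuitionistic → C.Pos classical
    la (atom⁺ p)   = C.!⟨ 𝗐 , 𝗅 ⟩ C.atom⁺ p
    la (!⟨ z ⟩ A)  = C.!⟨ z , 𝗅 ⟩ lpᶜ A
    la (P ⊗ Q)     = la P C.⊗ la Q
    la 𝟏           = C.𝟏
    la (P ⊕ Q)     = la P C.⊕ la Q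
    la 𝟎           = C.𝟎

    raᶜ : I.Ň → C.Neg classical
    raᶜ (atom⁺ p) = C.?⟨ 𝗐 , 𝗋 ⟩ C.pos (C.atom⁺ p)
    raᶜ (neg N)   = ra N

    ra : I.Neg intuitionistic → C.Neg classical
    ra (atom⁻ n)   = C.?⟨ 𝗐 , 𝗋 ⟩ C.atom⁻ n
    ra (?⟨ z ⟩ A)  = C.?⟨ z , 𝗋 ⟩ rpʰ A
    ra (N & M)     = ra N C.& ra M
    ra ⊤⁻          = C.⊤⁻
    ra (P ⊸ N)     = la P C.⊸ ra N

    rpʰ : I.P̂ → C.P̂
    rpʰ (atom⁻ n) = C.atom⁻ n
    rpʰ (pos P)   = C.pos (rf P)

  lp : Zone × I.Ň → (Zone × Side) × C.Ň
  lp (z ⦂ A) = (z , 𝗅) ⦂ lpᶜ A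

  rp : Zone × I.P̂ → (Zone × Side) × C.P̂
  rp (z ⦂ A) = (z , 𝗋) ⦂ rpʰ A

  E : I.Sequent → C.Sequent
  E (Γ ⊢[ P ])      = map lp Γ ⊢[ rf P ]⨟ []
  E (Γ ⨟[ N ]⊢ δ)   = map lp Γ C.⨟[ lf N ]⊢ (rp δ ∷ [])
  E (Γ ⨟ Ω ⊢ A ⨟·)  = map lp Γ ⨟ map (C.pos ∘ laʰ) Ω ⊢ C.neg (raᶜ A) ∷ [] ⨟ []
  E (Γ ⨟ Ω ⊢ ·⨟ δ)  = map lp Γ ⨟ map (C.pos ∘ laʰ) Ω ⊢ [] ⨟ (rp δ ∷ [])

{-# OPTIONS --safe #-}
module Submission where

-- Rule by rule, E maps intuitionistic derivations to classical ones.  A focus phase of a classical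
-- derivation of an encoded sequent uses images of intuitionistic rules only, because a passive
-- formula on the right is never available to a right focus.  Complete active phases from a given
-- sequent all have the same open premises: these are computed by operations, one for each active
-- formula, which commute.  Any two such phases are thus identified, and it suffices that every
-- intuitionistic active sequent has one.

open import Defs
open import Data.Empty using (⊥; ⊥-elim-irr)
open import Data.List.Base using (List; []; _∷_; _++_; map; foldr; concatMap)
open import Data.List.Properties using (map-++; concatMap-++; ++-identityʳ; ∷-injectiveˡ; ∷-injectiveʳ)
open import Data.List.Relation.Binary.Permutation.Propositional
  using (↭-refl; ↭-setoid; prep; swap)
open import Data.List.Relation.Binary.Permutation.Propositional.Properties
  using (↭-length; ↭-singleton-inv)
import Data.List.Relation.Binary.Permutation.Propositional.Properties as Perm
import Data.List.Relation.Binary.Permutation.Setoid as SetoidPermutation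
import Data.List.Relation.Binary.Permutation.Setoid.Properties as SetoidPermutationProperties
import Data.List.Relation.Binary.Pointwise as Pointwise
open import Data.List.Relation.Unary.All using (All; []; _∷_)
import Data.List.Relation.Unary.All as All
import Data.List.Relation.Unary.All.Properties as All
open import Data.Nat.Base using (ℕ; zero; suc)
open import Data.Nat.Properties using (suc-injective)
open import Data.Product.Base using (∃; Σ-syntax; ∃-syntax; _×_; _,_; proj₁)
open import Data.Product.Relation.Binary.Pointwise.NonDependent using (×-setoid)
open import Data.Sum.Base using (_⊎_; inj₁; inj₂)
open import Data.Unit.Base using (⊤; tt)
open import Function.Base using (case_of_)
open import Function.Bundles using (Bijection)
open import Level using (0ℓ)
open import Relation.Binary.Bundles using (Setoid)
open import Relation.Binary.Core using (Rel)
open import Relation.Binary.Construct.Closure.ReflexiveTransitive using (Star; ε; _◅_)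
open import Relation.Binary.PropositionalEquality
  using (_≡_; _≢_; refl; sym; trans; cong; cong₂; subst)
open import Relation.Binary.Structures using (IsPreorder)
open import Relation.Nullary using (¬_; contradiction)

-- The obstacle is injectivity. `E` identifies distinct neutral sequents, so encoded open premises
-- do not determine the original ones, and an identification of lifted derivations cannot be decoded
-- leaf by leaf. Two facts replace decoding. The identification never alters focus and decision
-- rules, and their numerical codes determine the intuitionistic rule and hence its premises. Both
-- derivations thus enter each active phase at the same intuitionistic sequent, where uniqueness of
-- the open premises within the intuitionistic calculus identifies them. For surjectivity, a
-- classical active phase is matched with an arbitrary intuitionistic phase from the same sequent,
-- whose lift is identified with it by uniqueness in the classical calculus. Uniqueness is therefore
-- proved over an abstract calculus and instantiated twice.

Remove-map⁺ : ∀ {A B : Set} (f : A → B) {x xs ys} →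
              Remove x xs ys → Remove (f x) (map f xs) (map f ys)
Remove-map⁺ f here      = here
Remove-map⁺ f (there r) = there (Remove-map⁺ f r)

-- Commuting operations on multisets

infixr 7 _·_
infixr 6 _+_

-- What the active rules make of a formula: ⟨ a ⟩ stores a in a passive context, while _·_, 𝟙 and
-- _+_, 𝟘 are the rules that keep a single premise and those that branch or close.
data Op (A : Set) : Set where
  ⟨_⟩     : A → Op A
  𝟙 𝟘     : Op A
  _·_ _+_ : Op A → Op A → Op A

∏ : ∀ {A} → List (Op A) → Op A
∏ = foldr _·_ 𝟙

module Run
  {A : Set} (M : Setoid 0ℓ 0ℓ)
  (act : A → Setoid.Carrier M → Setoid.Carrier M)
  (act-cong : ∀ a {x y} → Setoid._≈_ M x y → Setoid._≈_ M (act a x) (act a y))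
  (act-comm : ∀ a b x → Setoid._≈_ M (act a (act b x)) (act b (act a x)))
  where

  open Setoid M using () renaming (Carrier to X)

  open SetoidPermutation M public
    using () renaming (_↭_ to _↭ᴹ_; ↭-refl to ↭ᴹ-refl; ↭-sym to ↭ᴹ-sym; ↭-trans to ↭ᴹ-trans;
                       ↭-reflexive to ↭ᴹ-reflexive)
  open SetoidPermutation M using (↭-reflexive-≋)
  module Prop = SetoidPermutationProperties M

  -- A list up to permutation is a formal sum, on which an operation acts as a polynomial: branching
  -- duplicates everything collected so far, and closing deletes it.
  run : Op A → List X → List X
  run ⟨ a ⟩   xs = map (act a) xs
  run 𝟙       xs = xs
  run 𝟘       xs = []
  run (o · p) xs = run o (run p xs)
  run (o + p) xs = run o xs ++ run p xs

  run-cong : ∀ o {xs ys} → xs ↭ᴹ ys → run o xs ↭ᴹ run o ys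
  run-cong ⟨ a ⟩   e = Prop.map⁺ M (act-cong a) e
  run-cong 𝟙       e = e
  run-cong 𝟘       e = ↭ᴹ-refl
  run-cong (o · p) e = run-cong o (run-cong p e)
  run-cong (o + p) e = Prop.++⁺ (run-cong o e) (run-cong p e)

  run-[] : ∀ o → run o [] ≡ []
  run-[] ⟨ a ⟩   = refl
  run-[] 𝟙       = refl
  run-[] 𝟘       = refl
  run-[] (o · p) = trans (cong (run o) (run-[] p)) (run-[] o)
  run-[] (o + p) = cong₂ _++_ (run-[] o) (run-[] p)

  ++-interchange : ∀ ws xs ys zs → (ws ++ xs) ++ (ys ++ zs) ↭ᴹ (ws ++ ys) ++ (xs ++ zs)
  ++-interchange ws xs ys zs = ↭ᴹ-trans (Prop.++-assoc ws xs (ys ++ zs))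
    (↭ᴹ-trans (Prop.++⁺ˡ ws (Prop.shifts xs ys)) (↭ᴹ-sym (Prop.++-assoc ws ys (xs ++ zs))))

  run-++ : ∀ o xs ys → run o (xs ++ ys) ↭ᴹ run o xs ++ run o ys
  run-++ ⟨ a ⟩   xs ys = ↭ᴹ-reflexive (map-++ (act a) xs ys)
  run-++ 𝟙       xs ys = ↭ᴹ-refl
  run-++ 𝟘       xs ys = ↭ᴹ-refl
  run-++ (o · p) xs ys = ↭ᴹ-trans (run-cong o (run-++ p xs ys)) (run-++ o (run p xs) (run p ys))
  run-++ (o + p) xs ys = ↭ᴹ-trans (Prop.++⁺ (run-++ o xs ys) (run-++ p xs ys))
                                  (++-interchange (run o xs) (run o ys) (run p xs) (run p ys))

  run-act : ∀ o a xs → run o (map (act a) xs) ↭ᴹ map (act a) (run o xs)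
  run-act ⟨ b ⟩   a xs = ↭-reflexive-≋ (Pointwise.map⁺ _ _ (Pointwise.map⁺ _ _ (Pointwise.refl (act-comm b a _))))
  run-act 𝟙       a xs = ↭ᴹ-refl
  run-act 𝟘       a xs = ↭ᴹ-refl
  run-act (o · p) a xs = ↭ᴹ-trans (run-cong o (run-act p a xs)) (run-act o a (run p xs))
  run-act (o + p) a xs = ↭ᴹ-trans (Prop.++⁺ (run-act o a xs) (run-act p a xs))
                                  (↭ᴹ-reflexive (sym (map-++ (act a) (run o xs) (run p xs))))

  -- Polynomials in commuting generators commute: the generators do by `act-comm`, and `run-[]` and
  -- `run-++` give the additivity that `𝟘` and `_+_` require.
  run-comm : ∀ o p xs → run o (run p xs) ↭ᴹ run p (run o xs)
  run-comm ⟨ a ⟩   q xs = ↭ᴹ-sym (run-act q a xs)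
  run-comm 𝟙       q xs = ↭ᴹ-refl
  run-comm 𝟘       q xs = ↭ᴹ-reflexive (sym (run-[] q))
  run-comm (o · p) q xs = ↭ᴹ-trans (run-cong o (run-comm p q xs)) (run-comm o q (run p xs))
  run-comm (o + p) q xs = ↭ᴹ-trans (Prop.++⁺ (run-comm o q xs) (run-comm p q xs))
                                   (↭ᴹ-sym (run-++ q (run o xs) (run p xs)))

  -- Lets any active formula be treated as the outermost one, so it is immaterial which formula a
  -- rule picks.
  run-∏ : ∀ {o os ps} → Remove o os ps → ∀ xs → run (∏ os) xs ↭ᴹ run o (run (∏ ps) xs)
  run-∏ here                      xs = ↭ᴹ-refl
  run-∏ {o} (there {y = p} r) xs = ↭ᴹ-trans (run-cong p (run-∏ r xs)) (run-comm p o _)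

-- Active formulas as operations on pairs of passive contexts

module Decomposition (𝔸 : Atoms) (Sig : Signature) where
  open Signature Sig
  open Formulas 𝔸 Zone

  Passive : Logic → Set
  Passive L = (Zone × Check L) ⊎ (Zone × Hat L)

  mutual
    op⁺ : ∀ {L} → Pos L → Op (Passive L)
    op⁺ (atom⁺ p)  = ⟨ inj₁ (𝗐 ⦂ atom⁺ p) ⟩
    op⁺ (P ⊗ Q)    = op⁺ P · op⁺ Q
    op⁺ 𝟏          = 𝟙
    op⁺ (P ⊕ Q)    = op⁺ P + op⁺ Q
    op⁺ 𝟎          = 𝟘
    op⁺ (!⟨ z ⟩ A) = ⟨ inj₁ (z ⦂ A) ⟩

    op⁻ : ∀ {L} → Neg L → Op (Passive L)
    op⁻ (atom⁻ n)  = ⟨ inj₂ (𝗐 ⦂ atom⁻ n) ⟩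
    op⁻ (N & M)    = op⁻ N + op⁻ M
    op⁻ ⊤⁻         = 𝟘
    op⁻ (N ⅋ M)    = op⁻ N · op⁻ M
    op⁻ ⊥⁻         = 𝟙
    op⁻ (P ⊸ N)    = op⁺ P · op⁻ N
    op⁻ (?⟨ z ⟩ A) = ⟨ inj₂ (z ⦂ A) ⟩

  opʰ : ∀ {L} → Hat L → Op (Passive L)
  opʰ (pos P)   = op⁺ P
  opʰ (atom⁻ n) = ⟨ inj₁ (𝗐 ⦂ neg (atom⁻ n)) ⟩

  opᶜ : ∀ {L} → Check L → Op (Passive L)
  opᶜ (neg N)   = op⁻ N
  opᶜ (atom⁺ p) = ⟨ inj₂ (𝗐 ⦂ pos (atom⁺ p)) ⟩

  module _ {L : Logic} where
    Form : Setoid 0ℓ 0ℓ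
    Form = ×-setoid (↭-setoid {A = Zone × Check L}) (↭-setoid {A = Zone × Hat L})

    open Setoid Form public using () renaming (Carrier to ∣Form∣; _≈_ to _≈ᶠ_)

    add : Passive L → ∣Form∣ → ∣Form∣
    add (inj₁ x) (Γ , Δ) = x ∷ Γ , Δ
    add (inj₂ y) (Γ , Δ) = Γ , y ∷ Δ

    add-cong : ∀ a {x y} → x ≈ᶠ y → add a x ≈ᶠ add a y
    add-cong (inj₁ x) (p , q) = prep x p , q
    add-cong (inj₂ y) (p , q) = p , prep y q

    add-comm : ∀ a b x → add a (add b x) ≈ᶠ add b (add a x)
    add-comm (inj₁ a) (inj₁ b) x = swap a b ↭-refl , ↭-refl
    add-comm (inj₁ a) (inj₂ b) x = ↭-refl , ↭-refl
    add-comm (inj₂ a) (inj₁ b) x = ↭-refl , ↭-refl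
    add-comm (inj₂ a) (inj₂ b) x = ↭-refl , swap a b ↭-refl

    open Run Form add add-cong add-comm public

    -- The open premises predicted for a complete active phase, computed from the single form
    -- `(Γ , Δ)`.
    forms : List (Zone × Check L) → List (Hat L) → List (Check L) → List (Zone × Hat L) → List ∣Form∣
    forms Γ Ω Ξ Δ = run (∏ (map opᶜ Ξ)) (run (∏ (map opʰ Ω)) ((Γ , Δ) ∷ []))

    module _ {Γ : List (Zone × Check L)} {Δ : List (Zone × Hat L)} where
      -- Also serves `⊗L` and `𝟏L`: running a product or the unit unfolds definitionally to running
      -- the operations of the premise.
      left : ∀ {A Ω Ω′ Ξ} → Remove A Ω Ω′ →
             forms Γ (A ∷ Ω′) Ξ Δ ↭ᴹ forms Γ Ω Ξ Δ
      left {Ξ = Ξ} r = run-cong (∏ (map opᶜ Ξ)) (↭ᴹ-sym (run-∏ (Remove-map⁺ opʰ r) _))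

      right : ∀ {A Ω Ξ Ξ′} → Remove A Ξ Ξ′ →
              forms Γ Ω (A ∷ Ξ′) Δ ↭ᴹ forms Γ Ω Ξ Δ
      right r = ↭ᴹ-sym (run-∏ (Remove-map⁺ opᶜ r) _)

      -- The premise has `x` stored before the remaining operations run; by `run-act` this equals
      -- storing it after them.
      left-passive : ∀ {A x Ω Ω′ Ξ} → opʰ A ≡ ⟨ inj₁ x ⟩ → Remove A Ω Ω′ →
                     forms (x ∷ Γ) Ω′ Ξ Δ ++ [] ↭ᴹ forms Γ Ω Ξ Δ
      left-passive {x = x} {Ω′ = Ω′} {Ξ} e r = ↭ᴹ-trans (↭ᴹ-reflexive (++-identityʳ _))
        (↭ᴹ-trans (run-cong (∏ (map opᶜ Ξ)) (↭ᴹ-trans (run-act (∏ (map opʰ Ω′)) (inj₁ x) _)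
           (↭ᴹ-reflexive (cong (λ o → run o _) (sym e))))) (left {Ξ = Ξ} r))

      right-passive : ∀ {A y Ω Ξ Ξ′} → opᶜ A ≡ ⟨ inj₂ y ⟩ → Remove A Ξ Ξ′ →
                      forms Γ Ω Ξ′ (y ∷ Δ) ++ [] ↭ᴹ forms Γ Ω Ξ Δ
      right-passive {y = y} {Ω} {Ξ′ = Ξ′} e r = ↭ᴹ-trans (↭ᴹ-reflexive (++-identityʳ _))
        (↭ᴹ-trans (run-cong (∏ (map opᶜ Ξ′)) (run-act (∏ (map opʰ Ω)) (inj₂ y) _))
        (↭ᴹ-trans (run-act (∏ (map opᶜ Ξ′)) (inj₂ y) _)
        (↭ᴹ-trans (↭ᴹ-reflexive (cong (λ o → run o _) (sym e))) (right {Ω = Ω} r))))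

      -- The operations of `Ξ` act outside the branching and distribute over it because they are
      -- additive.
      left-⊕ : ∀ {P Q Ω Ω′ Ξ} → Remove (pos (P ⊕ Q)) Ω Ω′ →
               forms Γ (pos P ∷ Ω′) Ξ Δ ++ forms Γ (pos Q ∷ Ω′) Ξ Δ ++ [] ↭ᴹ forms Γ Ω Ξ Δ
      left-⊕ {P} {Q} {Ω′ = Ω′} {Ξ} r = ↭ᴹ-trans
        (Prop.++⁺ˡ (forms Γ (pos P ∷ Ω′) Ξ Δ) (↭ᴹ-reflexive (++-identityʳ _)))
        (↭ᴹ-trans (↭ᴹ-sym (run-++ (∏ (map opᶜ Ξ)) _ _)) (left {Ξ = Ξ} r))

      left-𝟎 : ∀ {Ω Ω′ Ξ} → Remove (pos 𝟎) Ω Ω′ → [] ↭ᴹ forms Γ Ω Ξ Δ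
      left-𝟎 {Ξ = Ξ} r = ↭ᴹ-trans (↭ᴹ-reflexive (sym (run-[] (∏ (map opᶜ Ξ))))) (left {Ξ = Ξ} r)

      right-& : ∀ {N M Ω Ξ Ξ′} → Remove (neg (N & M)) Ξ Ξ′ →
                forms Γ Ω (neg N ∷ Ξ′) Δ ++ forms Γ Ω (neg M ∷ Ξ′) Δ ++ [] ↭ᴹ forms Γ Ω Ξ Δ
      right-& {N} {M} {Ω} {Ξ′ = Ξ′} r = ↭ᴹ-trans
        (Prop.++⁺ˡ (forms Γ Ω (neg N ∷ Ξ′) Δ) (↭ᴹ-reflexive (++-identityʳ _))) (right {Ω = Ω} r)

      -- `⊸R` sends `P` to the left, among the operations applied before those on the right;
      -- commutation brings it back next to `op⁻ N`.
      right-⊸ : ∀ {P N Ω Ξ Ξ′} → Remove (neg (P ⊸ N)) Ξ Ξ′ →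
                forms Γ (pos P ∷ Ω) (neg N ∷ Ξ′) Δ ++ [] ↭ᴹ forms Γ Ω Ξ Δ
      right-⊸ {P} {N} {Ω} {Ξ′ = Ξ′} r = ↭ᴹ-trans (↭ᴹ-reflexive (++-identityʳ _))
        (↭ᴹ-trans (run-comm (∏ (map opᶜ (neg N ∷ Ξ′))) (op⁺ P) _) (right {Ω = Ω} r))

  ++[]-↭ : ∀ {L xs ys} → _↭ᴹ_ {L} xs ys → xs ++ [] ↭ᴹ ys
  ++[]-↭ {xs = xs} e = ↭ᴹ-trans (↭ᴹ-reflexive (++-identityʳ xs)) e

-- Uniqueness of complete active phases in an abstract calculus

module Phases (C : Calculus) where
  open Calculus C
  open Derivations C

  -- What a synthetic derivation carries above its decision: focus and active rules up to neutral
  -- leaves.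
  Complete : ∀ {S} → Derivation S → Set
  Complete d = DecisionFree d × All Neutral (leaves d)

  Complete* : ∀ {Ss} → All Derivation Ss → Set
  Complete* ds = DecisionFree* ds × All Neutral (leaves* ds)

  module _ {S : Sequent} {Ss : List Sequent} (d : Derivation S) (ds : All Derivation Ss) where
    Complete-head : Complete* (d ∷ ds) → Complete d
    Complete-head ((p , _) , ns) = p , All.++⁻ˡ (leaves d) ns

    Complete-tail : Complete* (d ∷ ds) → Complete* ds
    Complete-tail ((_ , ps) , ns) = ps , All.++⁻ʳ (leaves d) ns

    Complete-∷ : Complete d → Complete* ds → Complete* (d ∷ ds)
    Complete-∷ (p , ns) (ps , ms) = (p , ps) , All.++⁺ ns ms

  Complete-infer : ∀ {k Ss S} (r : Rule k Ss S) (ds : All Derivation Ss) →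
                   k ≢ decision → Complete* ds → Complete (infer r ds)
  Complete-infer r ds k≢ (ps , ns) = (k≢ , ps) , ns

  ≈-infer⇒≈* : ∀ {k Ss S} {r : Rule k Ss S} {ds es} → k ≢ active → infer r ds ≈ infer r es → ds ≈* es
  ≈-infer⇒≈* k≢ (infer _ p) = p
  ≈-infer⇒≈* k≢ (active _)  = contradiction refl k≢

  -- Each sequent is valued in a multiset that every active rule preserves (`sound`). On a neutral
  -- sequent the value is a single form, from which `readback` restores the sequent.
  module ActivePhase
    (M : Setoid 0ℓ 0ℓ) (⟦_⟧ : Sequent → List (Setoid.Carrier M))
    (readback : Setoid.Carrier M → Sequent)
    (readback-cong : ∀ {x y} → Setoid._≈_ M x y → readback x ≋ readback y)
    (readback-neutral : ∀ {S} → Neutral S → map readback ⟦ S ⟧ ≡ S ∷ [])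
    (Active : Sequent → Set)
    (active-rule : ∀ {k Ss S} → Active S → k ≢ decision → Rule k Ss S → k ≡ active)
    (sound : ∀ {Ss S} → Rule active Ss S →
             All Active (S ∷ Ss) × SetoidPermutation._↭_ M (concatMap ⟦_⟧ Ss) ⟦ S ⟧)
    where

    open SetoidPermutation M
      using () renaming (_↭_ to _↭ᴹ_; ↭-refl to ↭ᴹ-refl; ↭-sym to ↭ᴹ-sym; ↭-trans to ↭ᴹ-trans;
                         ↭-reflexive to ↭ᴹ-reflexive)
    private module Prop = SetoidPermutationProperties M

    mutual
      ⟦leaves⟧ : ∀ {S} → Active S → (d : Derivation S) → DecisionFree d →
                 concatMap ⟦_⟧ (leaves d) ↭ᴹ ⟦ S ⟧
      ⟦leaves⟧ a leaf _ = ↭ᴹ-reflexive (++-identityʳ _)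
      ⟦leaves⟧ a (infer r ds) (k≢ , p) with refl ← active-rule a k≢ r with (_ ∷ as) , e ← sound r =
        ↭ᴹ-trans (⟦leaves*⟧ as ds p) e

      ⟦leaves*⟧ : ∀ {Ss} → All Active Ss → (ds : All Derivation Ss) → DecisionFree* ds →
                  concatMap ⟦_⟧ (leaves* ds) ↭ᴹ concatMap ⟦_⟧ Ss
      ⟦leaves*⟧ []       []       _       = ↭ᴹ-refl
      ⟦leaves*⟧ (a ∷ as) (d ∷ ds) (p , q) =
        ↭ᴹ-trans (↭ᴹ-reflexive (concatMap-++ ⟦_⟧ (leaves d) (leaves* ds)))
                 (Prop.++⁺ (⟦leaves⟧ a d p) (⟦leaves*⟧ as ds q))

    map-readback : ∀ {Ss} → All Neutral Ss → map readback (concatMap ⟦_⟧ Ss) ≡ Ss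
    map-readback []                   = refl
    map-readback {S ∷ Ss} (n ∷ ns) =
      trans (map-++ readback ⟦ S ⟧ _) (cong₂ _++_ (readback-neutral n) (map-readback ns))

    -- Both leaf lists have the value of the root, and neutral leaves can be read off from their
    -- values.
    leaves*-unique : ∀ {Ss Ts S} → Rule active Ss S → Rule active Ts S →
                     (ds : All Derivation Ss) (es : All Derivation Ts) →
                     Complete* ds → Complete* es → leaves* ds ↭ˢ leaves* es
    leaves*-unique r s ds es (p , ns) (q , ms)
      with (_ ∷ as) , e ← sound r | (_ ∷ bs) , f ← sound s =
        subst (_↭ˢ _) (map-readback ns) (subst (_ ↭ˢ_) (map-readback ms)
          (Prop.map⁺ sequents readback-cong
            (↭ᴹ-trans (⟦leaves*⟧ as ds p) (↭ᴹ-trans e (↭ᴹ-sym (↭ᴹ-trans (⟦leaves*⟧ bs es q) f))))))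

    -- A non-neutral root cannot itself be an open leaf, so both derivations end in active rules and
    -- the constructor `active` compares them.
    ≈-active : ∀ {S} → Active S → ¬ Neutral S → {d e : Derivation S} → Complete d → Complete e → d ≈ e
    ≈-active a ¬n {leaf}       (_ , n ∷ []) _ = contradiction n ¬n
    ≈-active a ¬n {infer _ _} {leaf} _ (_ , n ∷ []) = contradiction n ¬n
    ≈-active a ¬n {infer r ds} {infer s es} ((k≢ , p) , ns) ((l≢ , q) , ms)
      with refl ← active-rule a k≢ r | refl ← active-rule a l≢ s =
        active (leaves*-unique r s ds es (p , ns) (q , ms))

-- Transport of derivations along a map of rules

module RuleMap (C D : Calculus) (f : Calculus.Sequent C → Calculus.Sequent D)
  (f-cong : ∀ {S T} → Calculus._≋_ C S T → Calculus._≋_ D (f S) (f T))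
  (f-neutral : ∀ {S} → Calculus.Neutral C S → Calculus.Neutral D (f S))
  (f-rule : ∀ {k Ss S} → Calculus.Rule C k Ss S → Calculus.Rule D k (map f Ss) (f S))
  where

  private
    module C = Derivations C
    module D = Derivations D
    module CP = Phases C
    module DP = Phases D
  open Derivations using (leaf; infer; active; []; _∷_)

  mutual
    lift : ∀ {S} → C.Derivation S → D.Derivation (f S)
    lift leaf         = leaf
    lift (infer r ds) = infer (f-rule r) (lift* ds)

    lift* : ∀ {Ss} → All C.Derivation Ss → All D.Derivation (map f Ss)
    lift* []       = []
    lift* (d ∷ ds) = lift d ∷ lift* ds

  mutual
    leaves-lift : ∀ {S} (d : C.Derivation S) → D.leaves (lift d) ≡ map f (C.leaves d)
    leaves-lift leaf         = refl
    leaves-lift (infer r ds) = leaves-lift* ds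

    leaves-lift* : ∀ {Ss} (ds : All C.Derivation Ss) → D.leaves* (lift* ds) ≡ map f (C.leaves* ds)
    leaves-lift* []       = refl
    leaves-lift* (d ∷ ds) = trans (cong₂ _++_ (leaves-lift d) (leaves-lift* ds))
                                  (sym (map-++ f (C.leaves d) (C.leaves* ds)))

  leaves-lift*-cong : ∀ {Ss Ts} (ds : All C.Derivation Ss) (es : All C.Derivation Ts) →
                      C.leaves* ds C.↭ˢ C.leaves* es → D.leaves* (lift* ds) D.↭ˢ D.leaves* (lift* es)
  leaves-lift*-cong ds es p rewrite leaves-lift* ds | leaves-lift* es =
    SetoidPermutationProperties.map⁺ C.sequents D.sequents f-cong p

  mutual
    lift-cong : ∀ {S} {d e : C.Derivation S} → d C.≈ e → lift d D.≈ lift e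
    lift-cong leaf                         = leaf
    lift-cong (infer r p)                  = infer (f-rule r) (lift*-cong p)
    lift-cong (active {ds = ds} {es} p)    = active (leaves-lift*-cong ds es p)

    lift*-cong : ∀ {Ss} {ds es : All C.Derivation Ss} → ds C.≈* es → lift* ds D.≈* lift* es
    lift*-cong []       = []
    lift*-cong (p ∷ ps) = lift-cong p ∷ lift*-cong ps

  mutual
    DecisionFree-lift : ∀ {S} (d : C.Derivation S) → C.DecisionFree d → D.DecisionFree (lift d)
    DecisionFree-lift leaf         _       = tt
    DecisionFree-lift (infer r ds) (p , q) = p , DecisionFree-lift* ds q

    DecisionFree-lift* : ∀ {Ss} (ds : All C.Derivation Ss) → C.DecisionFree* ds → D.DecisionFree* (lift* ds)
    DecisionFree-lift* []       _       = tt
    DecisionFree-lift* (d ∷ ds) (p , q) = DecisionFree-lift d p , DecisionFree-lift* ds q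

  Neutral-map : ∀ {Ss} → All (Calculus.Neutral C) Ss → All (Calculus.Neutral D) (map f Ss)
  Neutral-map []       = []
  Neutral-map (n ∷ ns) = f-neutral n ∷ Neutral-map ns

  Complete-lift : ∀ {S} (d : C.Derivation S) → CP.Complete d → DP.Complete (lift d)
  Complete-lift d (p , ns) = DecisionFree-lift d p , subst (All _) (sym (leaves-lift d)) (Neutral-map ns)

  IsSynthetic-lift : ∀ {S} (d : C.Derivation S) → C.IsSynthetic d → D.IsSynthetic (lift d)
  IsSynthetic-lift (infer r ds) (p , q , ns) =
    p , DecisionFree-lift* ds q , subst (All _) (sym (leaves-lift* ds)) (Neutral-map ns)

-- Active phases of the two calculi

module ClassicalActive (𝔸 : Atoms) (Sig : Signature) where
  open CSL 𝔸 Sig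
  open Decomposition 𝔸 Sig

  -- Focused sequents do not occur inside an active phase; their value is a placeholder.
  ⟦_⟧ : Sequent → List (∣Form∣ {classical})
  ⟦ Γ ⊢[ P ]⨟ Δ ⟧ = []
  ⟦ Γ ⨟[ N ]⊢ Δ ⟧ = []
  ⟦ Γ ⨟ Ω ⊢ Ξ ⨟ Δ ⟧ = forms Γ Ω Ξ Δ

  readback : ∣Form∣ {classical} → Sequent
  readback (Γ , Δ) = Γ ⨟ [] ⊢ [] ⨟ Δ

  readback-cong : ∀ {x y} → x ≈ᶠ y → readback x ≋ readback y
  readback-cong (p , q) = active p ↭-refl ↭-refl q

  readback-neutral : ∀ {S} → Neutral S → map readback ⟦ S ⟧ ≡ S ∷ []
  readback-neutral neutral = refl

  Active : Sequent → Set
  Active (Γ ⊢[ P ]⨟ Δ)   = ⊥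
  Active (Γ ⨟[ N ]⊢ Δ)   = ⊥
  Active (Γ ⨟ Ω ⊢ Ξ ⨟ Δ) = ⊤

  active-rule : ∀ {k Ss S} → Active S → k ≢ decision → Rule k Ss S → k ≡ active
  active-rule {active}                   a k≢ r = refl
  active-rule {decision}                 a k≢ r = contradiction refl k≢
  active-rule {focus} {S = Γ ⨟ Ω ⊢ Ξ ⨟ Δ} a k≢ ()

  sound : ∀ {Ss S} → Rule active Ss S → All Active (S ∷ Ss) × (concatMap ⟦_⟧ Ss ↭ᴹ ⟦ S ⟧)
  sound (atom⁺R {Ω = Ω} r) = tt ∷ tt ∷ [] , right-passive {Ω = Ω} refl r
  sound (atom⁻R {Ω = Ω} r) = tt ∷ tt ∷ [] , right-passive {Ω = Ω} refl r
  sound (?R {Ω = Ω} r)     = tt ∷ tt ∷ [] , right-passive {Ω = Ω} refl r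
  sound (&R {Ω = Ω} r)     = tt ∷ tt ∷ tt ∷ [] , right-& {Ω = Ω} r
  sound (⊤R {Ω = Ω} r)     = tt ∷ [] , right {Ω = Ω} r
  sound (⅋R {Ω = Ω} r)     = tt ∷ tt ∷ [] , ++[]-↭ (right {Ω = Ω} r)
  sound (⊥R {Ω = Ω} r)     = tt ∷ tt ∷ [] , ++[]-↭ (right {Ω = Ω} r)
  sound (⊸R {Ω = Ω} r)     = tt ∷ tt ∷ [] , right-⊸ {Ω = Ω} r
  sound (atom⁺L {Ξ = Ξ} r) = tt ∷ tt ∷ [] , left-passive {Ξ = Ξ} refl r
  sound (atom⁻L {Ξ = Ξ} r) = tt ∷ tt ∷ [] , left-passive {Ξ = Ξ} refl r
  sound (!L {Ξ = Ξ} r)     = tt ∷ tt ∷ [] , left-passive {Ξ = Ξ} refl r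
  sound (⊗L {Ξ = Ξ} r)     = tt ∷ tt ∷ [] , ++[]-↭ (left {Ξ = Ξ} r)
  sound (𝟏L {Ξ = Ξ} r)     = tt ∷ tt ∷ [] , ++[]-↭ (left {Ξ = Ξ} r)
  sound (⊕L {Ξ = Ξ} r)     = tt ∷ tt ∷ tt ∷ [] , left-⊕ {Ξ = Ξ} r
  sound (𝟎L {Ξ = Ξ} r)     = tt ∷ [] , left-𝟎 {Ξ = Ξ} r

  open Phases calculus public
  open ActivePhase Form ⟦_⟧ readback readback-cong readback-neutral Active active-rule sound public

module IntuitionisticActive (𝔸 : Atoms) (Sig : Signature) where
  open ISL 𝔸 Sig
  open Decomposition 𝔸 Sig

  rightActive : Right → List Ň
  rightActive (A ⨟·) = A ∷ []
  rightActive (·⨟ δ) = []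

  rightPassive : Right → List (_ × P̂)
  rightPassive (A ⨟·) = []
  rightPassive (·⨟ δ) = δ ∷ []

  ⟦_⟧ : Sequent → List (∣Form∣ {intuitionistic})
  ⟦ Γ ⊢[ P ] ⟧    = []
  ⟦ Γ ⨟[ N ]⊢ δ ⟧ = []
  ⟦ Γ ⨟ Ω ⊢ ρ ⟧   = forms Γ Ω (rightActive ρ) (rightPassive ρ)

  -- Forms with other than one formula on the right do not arise; their image is junk.
  readback : ∣Form∣ {intuitionistic} → Sequent
  readback (Γ , δ ∷ []) = Γ ⨟ [] ⊢ ·⨟ δ
  readback (Γ , _)      = Γ ⊢[ 𝟏 ]

  -- Length is invariant under permutation, so related forms fall under the same clause of
  -- `readback`.
  readback-cong : ∀ {x y} → x ≈ᶠ y → readback x ≋ readback y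
  readback-cong {_ , []}        {_ , []}        (p , q) = right-focus p
  readback-cong {_ , []}        {_ , _ ∷ []}    (p , q) = case ↭-length q of λ ()
  readback-cong {_ , []}        {_ , _ ∷ _ ∷ _} (p , q) = case ↭-length q of λ ()
  readback-cong {_ , _ ∷ []}    {_ , []}        (p , q) = case ↭-length q of λ ()
  readback-cong {_ , _ ∷ []}    {_ , _ ∷ []}    (p , q) with refl ← ↭-singleton-inv q = active p ↭-refl
  readback-cong {_ , _ ∷ []}    {_ , _ ∷ _ ∷ _} (p , q) = case ↭-length q of λ ()
  readback-cong {_ , _ ∷ _ ∷ _} {_ , []}        (p , q) = case ↭-length q of λ ()
  readback-cong {_ , _ ∷ _ ∷ _} {_ , _ ∷ []}    (p , q) = case ↭-length q of λ ()
  readback-cong {_ , _ ∷ _ ∷ _} {_ , _ ∷ _ ∷ _} (p , q) = right-focus p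

  readback-neutral : ∀ {S} → Neutral S → map readback ⟦ S ⟧ ≡ S ∷ []
  readback-neutral neutral = refl

  Active : Sequent → Set
  Active (Γ ⊢[ P ])    = ⊥
  Active (Γ ⨟[ N ]⊢ δ) = ⊥
  Active (Γ ⨟ Ω ⊢ ρ)   = ⊤

  active-rule : ∀ {k Ss S} → Active S → k ≢ decision → Rule k Ss S → k ≡ active
  active-rule {active}                a k≢ r = refl
  active-rule {decision}              a k≢ r = contradiction refl k≢
  active-rule {focus} {S = Γ ⨟ Ω ⊢ ρ} a k≢ ()

  only : (A : Ň) → Remove A (A ∷ []) []
  only A = here

  sound : ∀ {Ss S} → Rule active Ss S → All Active (S ∷ Ss) × (concatMap ⟦_⟧ Ss ↭ᴹ ⟦ S ⟧)
  sound (atom⁺R {Ω = Ω} {p})    = tt ∷ tt ∷ [] , right-passive {Ω = Ω} refl (only (atom⁺ p))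
  sound (atom⁻R {Ω = Ω} {n})    = tt ∷ tt ∷ [] , right-passive {Ω = Ω} refl (only (neg (atom⁻ n)))
  sound (?R {Ω = Ω} {z} {A})    = tt ∷ tt ∷ [] , right-passive {Ω = Ω} refl (only (neg (?⟨ z ⟩ A)))
  sound (&R {Ω = Ω} {N} {M})    = tt ∷ tt ∷ tt ∷ [] , right-& {Ω = Ω} (only (neg (N & M)))
  sound (⊤R {Γ} {Ω})            = tt ∷ [] , right {Γ = Γ} {Δ = []} {Ω = Ω} (only (neg ⊤⁻))
  sound (⊸R {Ω = Ω} {P} {N})    = tt ∷ tt ∷ [] , right-⊸ {Ω = Ω} (only (neg (P ⊸ N)))
  sound (atom⁺L {ρ = ρ} r) = tt ∷ tt ∷ [] , left-passive {Ξ = rightActive ρ} refl r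
  sound (atom⁻L {ρ = ρ} r) = tt ∷ tt ∷ [] , left-passive {Ξ = rightActive ρ} refl r
  sound (!L {ρ = ρ} r)     = tt ∷ tt ∷ [] , left-passive {Ξ = rightActive ρ} refl r
  sound (⊗L {ρ = ρ} r)     = tt ∷ tt ∷ [] , ++[]-↭ (left {Ξ = rightActive ρ} r)
  sound (𝟏L {ρ = ρ} r)     = tt ∷ tt ∷ [] , ++[]-↭ (left {Ξ = rightActive ρ} r)
  sound (⊕L {ρ = ρ} r)     = tt ∷ tt ∷ tt ∷ [] , left-⊕ {Ξ = rightActive ρ} r
  sound (𝟎L {ρ = ρ} r)     = tt ∷ [] , left-𝟎 {Ξ = rightActive ρ} r

  open Phases calculus public
  open ActivePhase Form ⟦_⟧ readback readback-cong readback-neutral Active active-rule sound public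

  Phase : Sequent → Set
  Phase S = ∃ (Complete {S})

  unary : ∀ {S T} → Rule active (S ∷ []) T → Phase S → Phase T
  unary r (d , c) = infer r (d ∷ []) , Complete-infer r (d ∷ []) (λ ()) (Complete-∷ d [] c (tt , []))

  binary : ∀ {S S′ T} → Rule active (S ∷ S′ ∷ []) T → Phase S → Phase S′ → Phase T
  binary r (d , c) (d′ , c′) =
    infer r (d ∷ d′ ∷ []) ,
    Complete-infer r (d ∷ d′ ∷ []) (λ ()) (Complete-∷ d (d′ ∷ []) c (Complete-∷ d′ [] c′ (tt , [])))

  nullary : ∀ {T} → Rule active [] T → Phase T
  nullary r = infer r [] , Complete-infer r [] (λ ()) (tt , [])

  -- The rest of the phase is a continuation accepting any left passive context, since decomposing
  -- `P` may store formulas there; the recursion is then structural in `P`.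
  phase⁺ : ∀ P {Γ Ω ρ} → (∀ {Γ} → Phase (Γ ⨟ Ω ⊢ ρ)) → Phase (Γ ⨟ pos P ∷ Ω ⊢ ρ)
  phase⁺ (atom⁺ p)  f = unary (atom⁺L here) f
  phase⁺ (P ⊗ Q)    f = unary (⊗L here) (phase⁺ P (phase⁺ Q f))
  phase⁺ 𝟏          f = unary (𝟏L here) f
  phase⁺ (P ⊕ Q)    f = binary (⊕L here) (phase⁺ P f) (phase⁺ Q f)
  phase⁺ 𝟎          f = nullary (𝟎L here)
  phase⁺ (!⟨ z ⟩ A) f = unary (!L here) f

  phaseʰ : ∀ Ω {Γ δ} → Phase (Γ ⨟ Ω ⊢ ·⨟ δ)
  phaseʰ []           = leaf , tt , neutral ∷ []
  phaseʰ (pos P ∷ Ω)   = phase⁺ P (phaseʰ Ω)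
  phaseʰ (atom⁻ n ∷ Ω) = unary (atom⁻L here) (phaseʰ Ω)

  -- The right formula is exhausted first, because `⊸R` still adds to `Ω`; only then is `Ω`
  -- decomposed.
  phase⁻ : ∀ N {Γ} Ω → Phase (Γ ⨟ Ω ⊢ neg N ⨟·)
  phase⁻ (atom⁻ n)  Ω = unary atom⁻R (phaseʰ Ω)
  phase⁻ (N & M)    Ω = binary &R (phase⁻ N Ω) (phase⁻ M Ω)
  phase⁻ ⊤⁻         Ω = nullary ⊤R
  phase⁻ (P ⊸ N)    Ω = unary ⊸R (phase⁻ N (pos P ∷ Ω))
  phase⁻ (?⟨ z ⟩ A) Ω = unary ?R (phaseʰ Ω)

  phase : ∀ ρ {Γ Ω} → Phase (Γ ⨟ Ω ⊢ ρ)
  phase (neg N ⨟·)   {Ω = Ω} = phase⁻ N Ω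
  phase (atom⁺ p ⨟·) {Ω = Ω} = unary atom⁺R (phaseʰ Ω)
  phase (·⨟ δ)       {Ω = Ω} = phaseʰ Ω

-- Numerical codes of removals and splittings

module _ {A : Set} where
  -- A bare number, so that a removal and its image in the encoded context can be compared.
  position : ∀ {x : A} {xs ys} → Remove x xs ys → ℕ
  position here      = zero
  position (there r) = suc (position r)

  position-injective : ∀ {x x′ : A} {xs ys ys′} (r : Remove x xs ys) (s : Remove x′ xs ys′) →
    position r ≡ position s →
    _≡_ {A = ∃[ x ] ∃[ ys ] Remove x xs ys} (x , ys , r) (x′ , ys′ , s)
  position-injective here      here      e = refl
  position-injective (there r) (there s) e with refl ← position-injective r s (suc-injective e) = refl

  choices : ∀ {R : A → Set} {xs ys zs} → Split R xs ys zs → List ℕ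
  choices []           = []
  choices (shared _ s) = 0 ∷ choices s
  choices (first _ s)  = 1 ∷ choices s
  choices (second _ s) = 2 ∷ choices s

  choices-injective : ∀ {R : A → Set} {xs ys zs ys′ zs′} (s : Split R xs ys zs) (t : Split R xs ys′ zs′) →
    choices s ≡ choices t →
    _≡_ {A = ∃[ ys ] ∃[ zs ] Split R xs ys zs} (ys , zs , s) (ys′ , zs′ , t)
  choices-injective []           []           e = refl
  choices-injective (shared _ s) (shared _ t) e with refl ← choices-injective s t (∷-injectiveʳ e) = refl
  choices-injective (first _ s)  (first _ t)  e with refl ← choices-injective s t (∷-injectiveʳ e) = refl
  choices-injective (second _ s) (second _ t) e with refl ← choices-injective s t (∷-injectiveʳ e) = refl

position-map⁺ : ∀ {A B : Set} (f : A → B) {x xs ys} (r : Remove x xs ys) →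
                position (Remove-map⁺ f r) ≡ position r
position-map⁺ f here      = refl
position-map⁺ f (there r) = cong suc (position-map⁺ f r)

module Adequacy (𝔸 : Atoms) (Sig : Signature) where
  open Signature Sig
  open Encoding 𝔸 Sig
  open SplitForm Sig using (_⊏_; left; right; right-left)
  private
    module I = ISL 𝔸 Sig
    module C = CSL 𝔸 (split Sig)
    module IA = IntuitionisticActive 𝔸 Sig
    module CA = ClassicalActive 𝔸 (split Sig)
    module ≤ = IsPreorder isPreorder
    variable
      Γ Γ₁ Γ₂ : List (Zone × I.Ň)
      z x : Zone
      s t : Side
  open I using (atom⁺; atom⁻; _⊗_; 𝟏; _⊕_; 𝟎; !⟨_⟩_; _&_; ⊤⁻; _⊸_; ?⟨_⟩_; pos; neg;
                _⨟·; ·⨟_; _⊢[_]; _⨟[_]⊢_; _⨟_⊢_;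
                init⁺; ⊗R; 𝟏R; ⊕R₁; ⊕R₂; !R; init⁻; &L₁; &L₂; ⊸L; ?L;
                atom⁺R; atom⁻R; &R; ⊤R; ⊸R; ?R; atom⁺L; atom⁻L; ⊗L; 𝟏L; ⊕L; 𝟎L; !L;
                decideR; decideLʳ; decideLᵘ)
  open C using (_⊢[_]⨟_; _⨟_⊢_⨟_; decideRʳ; decideRᵘ)
  open Derivations using (leaf; infer)

  -- Side conditions in the split form and the encoding of rules

  _≤̂_ : Rel (Zone × Side) 0ℓ
  _≤̂_ = Star _⊏_

  ≤̂⇒≤ : (z , s) ≤̂ (x , t) → z ≤ x
  ≤̂⇒≤ ε                = ≤.refl
  ≤̂⇒≤ (left p ◅ ps)    = ≤.trans p (≤̂⇒≤ ps)
  ≤̂⇒≤ (right p ◅ ps)   = ≤.trans p (≤̂⇒≤ ps)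
  ≤̂⇒≤ (right-left ◅ ps) = ≤̂⇒≤ ps

  -- The only generator that changes side leads from `𝗋` to `𝗅`.
  𝗅≰̂𝗋 : ¬ (z , 𝗅) ≤̂ (x , 𝗋)
  𝗅≰̂𝗋 (left _ ◅ ps) = 𝗅≰̂𝗋 ps

  -- Left passive formulas live in `𝗅` zones, which lie above both copies of every smaller zone.
  -- Hence the encoded `!` (side `𝗅`) and `?` (side `𝗋`) constrain the left context as in the
  -- source.
  ≤⇒≤̂𝗅 : ∀ s → z ≤ x → (z , s) ≤̂ (x , 𝗅)
  ≤⇒≤̂𝗅 𝗅 p = left p ◅ ε
  ≤⇒≤̂𝗅 𝗋 p = right p ◅ right-left ◅ ε

  ≼⇒≼̂ : ∀ s → z I.≼ Γ → (z , s) C.≼ map lp Γ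
  ≼⇒≼̂ s []       = []
  ≼⇒≼̂ s (p ∷ ps) = ≤⇒≤̂𝗅 s p ∷ ≼⇒≼̂ s ps

  ≼̂⇒≼ : ∀ Γ → (z , s) C.≼ map lp Γ → z I.≼ Γ
  ≼̂⇒≼ []      []       = []
  ≼̂⇒≼ (_ ∷ Γ) (p ∷ ps) = ≤̂⇒≤ p ∷ ≼̂⇒≼ Γ ps

  unrestricted⁺ : All I.Unrestricted Γ → All C.Unrestricted (map lp Γ)
  unrestricted⁺ []       = []
  unrestricted⁺ (u ∷ us) = u ∷ unrestricted⁺ us

  unrestricted⁻ : ∀ Γ → All C.Unrestricted (map lp Γ) → All I.Unrestricted Γ
  unrestricted⁻ []      []       = []
  unrestricted⁻ (_ ∷ Γ) (u ∷ us) = u ∷ unrestricted⁻ Γ us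

  split⁺ : Split I.Unrestricted Γ Γ₁ Γ₂ → Split C.Unrestricted (map lp Γ) (map lp Γ₁) (map lp Γ₂)
  split⁺ []           = []
  split⁺ (shared u s) = shared u (split⁺ s)
  split⁺ (first r s)  = first r (split⁺ s)
  split⁺ (second r s) = second r (split⁺ s)

  choices-split⁺ : (s : Split I.Unrestricted Γ Γ₁ Γ₂) → choices (split⁺ s) ≡ choices s
  choices-split⁺ []           = refl
  choices-split⁺ (shared _ s) = cong (0 ∷_) (choices-split⁺ s)
  choices-split⁺ (first _ s)  = cong (1 ∷_) (choices-split⁺ s)
  choices-split⁺ (second _ s) = cong (2 ∷_) (choices-split⁺ s)

  E-rule : ∀ {k Ss S} → I.Rule k Ss S → C.Rule k (map E Ss) (E S)
  E-rule (init⁺ r u)    = C.init⁺ (Remove-map⁺ lp r) (unrestricted⁺ u) []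
  E-rule (⊗R s)         = C.⊗R (split⁺ s) []
  E-rule (𝟏R u)         = C.𝟏R (unrestricted⁺ u) []
  E-rule ⊕R₁            = C.⊕R₁
  E-rule ⊕R₂            = C.⊕R₂
  E-rule (!R p)         = C.!R (≼⇒≼̂ 𝗅 p) []
  E-rule (init⁻ u)      = C.init⁻ here (unrestricted⁺ u) []
  E-rule &L₁            = C.&L₁
  E-rule &L₂            = C.&L₂
  -- The right formula goes to the premise focused on `M`; its zone is restricted because `Û` is
  -- empty on side `𝗋`.
  E-rule (⊸L s)         = C.⊸L (split⁺ s) (second (λ ()) [])
  E-rule (?L p q)       = C.?L (≼⇒≼̂ 𝗋 p) ((right q ◅ ε) ∷ [])
  -- The encoding wraps a right active atom in `?`, so that it is stored in `(𝗐 , 𝗋)` and not in the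
  -- classical working zone `(𝗐 , 𝗅)`.
  E-rule atom⁺R         = C.?R here
  E-rule atom⁻R         = C.?R here
  E-rule &R             = C.&R here
  E-rule ⊤R             = C.⊤R here
  E-rule ⊸R             = C.⊸R here
  E-rule ?R             = C.?R here
  E-rule (atom⁺L {ρ = A ⨟·} r) = C.!L (Remove-map⁺ _ r)
  E-rule (atom⁺L {ρ = ·⨟ δ} r) = C.!L (Remove-map⁺ _ r)
  E-rule (atom⁻L {ρ = A ⨟·} r) = C.!L (Remove-map⁺ _ r)
  E-rule (atom⁻L {ρ = ·⨟ δ} r) = C.!L (Remove-map⁺ _ r)
  E-rule (⊗L {ρ = A ⨟·} r) = C.⊗L (Remove-map⁺ _ r)
  E-rule (⊗L {ρ = ·⨟ δ} r) = C.⊗L (Remove-map⁺ _ r)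
  E-rule (𝟏L {ρ = A ⨟·} r) = C.𝟏L (Remove-map⁺ _ r)
  E-rule (𝟏L {ρ = ·⨟ δ} r) = C.𝟏L (Remove-map⁺ _ r)
  E-rule (⊕L {ρ = A ⨟·} r) = C.⊕L (Remove-map⁺ _ r)
  E-rule (⊕L {ρ = ·⨟ δ} r) = C.⊕L (Remove-map⁺ _ r)
  E-rule (𝟎L {ρ = A ⨟·} r) = C.𝟎L (Remove-map⁺ _ r)
  E-rule (𝟎L {ρ = ·⨟ δ} r) = C.𝟎L (Remove-map⁺ _ r)
  E-rule (!L {ρ = A ⨟·} r) = C.!L (Remove-map⁺ _ r)
  E-rule (!L {ρ = ·⨟ δ} r) = C.!L (Remove-map⁺ _ r)
  -- Every encoded right zone is restricted, so the copy-free source decision becomes the restricted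
  -- one whatever the zone.
  E-rule decideR        = decideRʳ here (λ ())
  E-rule (decideLʳ r u) = C.decideLʳ (Remove-map⁺ lp r) u
  E-rule (decideLᵘ r u) = C.decideLᵘ (Remove-map⁺ lp r) u

  E-cong : ∀ {S T} → S I.≋ T → E S C.≋ E T
  E-cong (I.right-focus p)           = C.right-focus (Perm.map⁺ lp p) ↭-refl
  E-cong (I.left-focus p)            = C.left-focus (Perm.map⁺ lp p) ↭-refl
  E-cong (I.active {ρ = A ⨟·} p q)   = C.active (Perm.map⁺ lp p) (Perm.map⁺ _ q) ↭-refl ↭-refl
  E-cong (I.active {ρ = ·⨟ δ} p q)   = C.active (Perm.map⁺ lp p) (Perm.map⁺ _ q) ↭-refl ↭-refl

  E-neutral : ∀ {S} → I.Neutral S → C.Neutral (E S)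
  E-neutral I.neutral = C.neutral

  -- Injectivity up to identification

  open RuleMap I.calculus C.calculus E E-cong E-neutral E-rule

  -- E is not injective on neutral sequents, as lf identifies ?⟨ z ⟩ p with ?⟨ z ⟩ !⟨ 𝗐 ⟩ p.  A rule
  -- is therefore recovered from the positions it acts on, not from its encoded premises.
  code : ∀ {k Ss S} → C.Rule k Ss S → List ℕ
  code (C.init⁺ r _ _)  = position r ∷ []
  code (C.⊗R s _)       = choices s
  code C.⊕R₁            = 0 ∷ []
  code C.⊕R₂            = 1 ∷ []
  code C.&L₁            = 0 ∷ []
  code C.&L₂            = 1 ∷ []
  code (C.⊸L s _)       = choices s
  code (decideRʳ _ _)   = 0 ∷ []
  code (C.decideLʳ r _) = 1 ∷ position r ∷ []
  code (C.decideLᵘ r _) = 2 ∷ position r ∷ []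
  code _                = []

  positions-equal : ∀ {y y′ : Zone × I.Ň} (r : Remove y Γ Γ₁) (r′ : Remove y′ Γ Γ₂) →
    position (Remove-map⁺ lp r) ≡ position (Remove-map⁺ lp r′) →
    _≡_ {A = ∃[ y ] ∃[ Γ₁ ] Remove y Γ Γ₁} (y , Γ₁ , r) (y′ , Γ₂ , r′)
  positions-equal r r′ e =
    position-injective r r′ (trans (sym (position-map⁺ lp r)) (trans e (position-map⁺ lp r′)))

  choices-equal : ∀ {Γ₁′ Γ₂′} (s : Split I.Unrestricted Γ Γ₁ Γ₂) (s′ : Split I.Unrestricted Γ Γ₁′ Γ₂′) →
    choices (split⁺ s) ≡ choices (split⁺ s′) →
    _≡_ {A = ∃[ Γ₁ ] ∃[ Γ₂ ] Split I.Unrestricted Γ Γ₁ Γ₂} (Γ₁ , Γ₂ , s) (Γ₁′ , Γ₂′ , s′)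
  choices-equal s s′ e =
    choices-injective s s′ (trans (sym (choices-split⁺ s)) (trans e (choices-split⁺ s′)))

  -- Once the conclusion is fixed, such a rule is settled by the chosen component, position or
  -- splitting, which the code records; leading tags separate the three decisions.
  code-injective : ∀ {k k′ Ss Ss′ S} (r : I.Rule k Ss S) (r′ : I.Rule k′ Ss′ S) →
    k ≢ active → k′ ≢ active → code (E-rule r) ≡ code (E-rule r′) →
    _≡_ {A = ∃[ k ] ∃[ Ss ] I.Rule k Ss S} (k , Ss , r) (k′ , Ss′ , r′)
  code-injective {active} r r′ k≢ k′≢ e = contradiction refl k≢
  code-injective {_} {active} r r′ k≢ k′≢ e = contradiction refl k′≢
  code-injective {decision} {focus} {S = _ ⨟ _ ⊢ _} _ ()
  code-injective {focus} {decision} {S = _ ⨟ _ ⊢ _} ()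
  code-injective {focus} {focus} (init⁺ r _) (init⁺ r′ _) k≢ k′≢ e
    with refl ← positions-equal r r′ (∷-injectiveˡ e) = refl
  code-injective {focus} {focus} (⊗R s) (⊗R s′) k≢ k′≢ e with refl ← choices-equal s s′ e = refl
  code-injective {focus} {focus} (𝟏R _) (𝟏R _) k≢ k′≢ e = refl
  code-injective {focus} {focus} ⊕R₁ ⊕R₁ k≢ k′≢ e = refl
  code-injective {focus} {focus} ⊕R₂ ⊕R₂ k≢ k′≢ e = refl
  code-injective {focus} {focus} (!R _) (!R _) k≢ k′≢ e = refl
  code-injective {focus} {focus} (init⁻ _) (init⁻ _) k≢ k′≢ e = refl
  code-injective {focus} {focus} &L₁ &L₁ k≢ k′≢ e = refl
  code-injective {focus} {focus} &L₂ &L₂ k≢ k′≢ e = refl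
  code-injective {focus} {focus} (⊸L s) (⊸L s′) k≢ k′≢ e with refl ← choices-equal s s′ e = refl
  code-injective {focus} {focus} (?L _ _) (?L _ _) k≢ k′≢ e = refl
  code-injective {decision} {decision} decideR decideR k≢ k′≢ e = refl
  code-injective {decision} {decision} (decideLʳ r _) (decideLʳ r′ _) k≢ k′≢ e
    with refl ← positions-equal r r′ (∷-injectiveˡ (∷-injectiveʳ e)) = refl
  code-injective {decision} {decision} (decideLᵘ r _) (decideLᵘ r′ _) k≢ k′≢ e
    with refl ← positions-equal r r′ (∷-injectiveˡ (∷-injectiveʳ e)) = refl

  ≈⇒code≡ : ∀ {k k′ Ss Ss′ S} {r : C.Rule k Ss S} {r′ : C.Rule k′ Ss′ S} {ds es} →
            k ≢ active → infer r ds C.≈ infer r′ es → code r ≡ code r′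
  ≈⇒code≡ k≢ (C.infer _ _)  = refl
  ≈⇒code≡ k≢ (C.active _)   = contradiction refl k≢

  mutual
    lift-injective : ∀ {S} (d e : I.Derivation S) → IA.Complete d → IA.Complete e →
                     lift d C.≈ lift e → d I.≈ e
    lift-injective leaf leaf _ _ _ = I.leaf
    -- Both phases start from the same intuitionistic sequent, so uniqueness there identifies them
    -- without decoding any premise.
    lift-injective (infer {active} r ds) (infer {active} s es) ((_ , p) , ns) ((_ , q) , ms) _ =
      I.active (IA.leaves*-unique r s ds es (p , ns) (q , ms))
    lift-injective (infer {decision} r ds) _ ((k≢ , _) , _) _ _ = contradiction refl k≢
    lift-injective _ (infer {decision} s es) _ ((k≢ , _) , _) _ = contradiction refl k≢
    lift-injective (infer {focus} r ds) (infer {active} s es) _ _ ≈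
      with () ← IA.active-rule (All.head (proj₁ (IA.sound s))) (λ ()) r
    lift-injective (infer {active} r ds) (infer {focus} s es) _ _ ≈
      with () ← IA.active-rule (All.head (proj₁ (IA.sound r))) (λ ()) s
    lift-injective (infer {focus} r ds) (infer {focus} s es) ((_ , p) , ns) ((_ , q) , ms) ≈ =
      infer-injective r s (λ ()) (λ ()) (p , ns) (q , ms) ≈

    infer-injective : ∀ {k k′ Ss Ss′ S} (r : I.Rule k Ss S) (s : I.Rule k′ Ss′ S) {ds es} →
      k ≢ active → k′ ≢ active → IA.Complete* ds → IA.Complete* es →
      lift (infer r ds) C.≈ lift (infer s es) → infer r ds I.≈ infer s es
    -- Equal codes give equal rules, hence equal premise sequents, which makes the subderivations
    -- comparable.
    infer-injective r s k≢ k′≢ c c′ ≈ with refl ← code-injective r s k≢ k′≢ (≈⇒code≡ k≢ ≈) =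
      I.infer r (lift*-injective _ _ c c′ (CA.≈-infer⇒≈* k≢ ≈))

    lift*-injective : ∀ {Ss} (ds es : All I.Derivation Ss) → IA.Complete* ds → IA.Complete* es →
                      lift* ds C.≈* lift* es → ds I.≈* es
    lift*-injective []       []       c c′ C.[]       = I.[]
    lift*-injective (d ∷ ds) (e ∷ es) c c′ (p C.∷ ps) =
      lift-injective d e (IA.Complete-head d ds c) (IA.Complete-head e es c′) p I.∷
      lift*-injective ds es (IA.Complete-tail d ds c) (IA.Complete-tail e es c′) ps

  -- Surjectivity up to identification

  -- `lpᶜ` keeps positive atoms and negative formulas apart, so removing an atom from an encoded
  -- context is the image of removing an atom from the original one.
  data AtomView {Γ} : ∀ {ẑ : Zone × Side} {p Γ̂} → Remove (ẑ ⦂ C.atom⁺ p) (map lp Γ) Γ̂ → Set where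
    image : ∀ {z p Γ′} (r : Remove (z ⦂ atom⁺ p) Γ Γ′) → AtomView (Remove-map⁺ lp r)

  atomView : ∀ Γ {ẑ p Γ̂} (r : Remove (ẑ ⦂ C.atom⁺ p) (map lp Γ) Γ̂) → AtomView {Γ} r
  atomView ((z ⦂ atom⁺ p) ∷ Γ) here = image here
  atomView (x ∷ Γ) (there r) with image r′ ← atomView Γ r = image (there r′)

  data NegView {Γ} : ∀ {ẑ : Zone × Side} {N̂ Γ̂} → Remove (ẑ ⦂ C.neg N̂) (map lp Γ) Γ̂ → Set where
    image : ∀ {z N Γ′} (r : Remove (z ⦂ neg N) Γ Γ′) → NegView (Remove-map⁺ lp r)

  negView : ∀ Γ {ẑ N̂ Γ̂} (r : Remove (ẑ ⦂ C.neg N̂) (map lp Γ) Γ̂) → NegView {Γ} r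
  negView ((z ⦂ neg N) ∷ Γ) here = image here
  negView (x ∷ Γ) (there r) with image r′ ← negView Γ r = image (there r′)

  data SplitView {Γ} : ∀ {Γ̂₁ Γ̂₂} → Split C.Unrestricted (map lp Γ) Γ̂₁ Γ̂₂ → Set where
    image : ∀ {Γ₁ Γ₂} (s : Split I.Unrestricted Γ Γ₁ Γ₂) → SplitView (split⁺ s)

  splitView : ∀ Γ {Γ̂₁ Γ̂₂} (s : Split C.Unrestricted (map lp Γ) Γ̂₁ Γ̂₂) → SplitView {Γ} s
  splitView []      []           = image []
  splitView (x ∷ Γ) (shared u s) with image s′ ← splitView Γ s = image (shared u s′)
  splitView (x ∷ Γ) (first r s)  with image s′ ← splitView Γ s = image (first r s′)
  splitView (x ∷ Γ) (second r s) with image s′ ← splitView Γ s = image (second r s′)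

  -- Why the split form works: zones (x , 𝗋) are restricted and lie above no (z , 𝗅), so that in
  -- ⊸L the right formula can only go to the premise focused on the negative formula.
  no-complete-right-focus : ∀ P {Γ̂ x B} (c : C.Derivation (Γ̂ ⊢[ rf P ]⨟ ((x , 𝗋) ⦂ B) ∷ [])) → ¬ CA.Complete c
  no-complete-right-focus (P ⊗ Q) (infer (C.⊗R _ (first _ [])) (c ∷ d ∷ [])) ((_ , p) , ns) =
    no-complete-right-focus P c (CA.Complete-head c (d ∷ []) (p , ns))
  no-complete-right-focus (P ⊗ Q) (infer (C.⊗R _ (second _ [])) (c ∷ d ∷ [])) ((_ , p) , ns) =
    no-complete-right-focus Q d (CA.Complete-head d [] (CA.Complete-tail c (d ∷ []) (p , ns)))
  no-complete-right-focus (P ⊗ Q) (infer (C.⊗R _ (shared u _)) _) _ = ⊥-elim-irr u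
  no-complete-right-focus (P ⊕ Q) (infer C.⊕R₁ (c ∷ [])) ((_ , p) , ns) =
    no-complete-right-focus P c (CA.Complete-head c [] (p , ns))
  no-complete-right-focus (P ⊕ Q) (infer C.⊕R₂ (c ∷ [])) ((_ , p) , ns) =
    no-complete-right-focus Q c (CA.Complete-head c [] (p , ns))
  no-complete-right-focus (atom⁺ p) (infer (C.init⁺ _ _ u) []) _ = ⊥-elim-irr (All.head u)
  no-complete-right-focus 𝟏 (infer (C.𝟏R _ u) []) _ = ⊥-elim-irr (All.head u)
  no-complete-right-focus (!⟨ z ⟩ A) (infer (C.!R _ q) _) _ = ⊥-elim-irr (𝗅≰̂𝗋 (All.head q))
  no-complete-right-focus _ leaf (_ , () ∷ _)

  Preimage : ∀ {S} → C.Derivation (E S) → Set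
  Preimage {S} c = ∃[ d ] IA.Complete {S} d × lift d C.≈ c

  Preimage* : ∀ {Ss} → All C.Derivation (map E Ss) → Set
  Preimage* {Ss} cs = ∃[ ds ] IA.Complete* {Ss} ds × lift* ds C.≈* cs

  preimage[] : Preimage* {[]} []
  preimage[] = [] , (tt , []) , C.[]

  preimage∷ : ∀ {S Ss} {c : C.Derivation (E S)} {cs : All C.Derivation (map E Ss)} →
              Preimage {S} c → Preimage* {Ss} cs → Preimage* {S ∷ Ss} (c ∷ cs)
  preimage∷ (d , p , e) (ds , q , es) = d ∷ ds , IA.Complete-∷ d ds p q , e C.∷ es

  preimage-infer : ∀ {k Ss S} (r : I.Rule k Ss S) {cs : All C.Derivation (map E Ss)} → k ≢ decision →
                   Preimage* {Ss} cs → Preimage {S} (infer (E-rule r) cs)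
  preimage-infer r k≢ (ds , p , es) = infer r ds , IA.Complete-infer r ds k≢ p , C.infer (E-rule r) es

  -- The given intuitionistic phase need not be built from `c`: its lift is complete as well, and
  -- complete phases from one sequent are identified.
  preimage-active : ∀ {S} → IA.Phase S → CA.Active (E S) → ¬ C.Neutral (E S) →
                    (c : C.Derivation (E S)) → CA.Complete c → Preimage {S} c
  preimage-active (d , p) a ¬n c q = d , p , CA.≈-active a ¬n (Complete-lift d p) q

  -- `rf` preserves the outermost connective and the right context stays empty, so every rule is the
  -- image of an intuitionistic one until `!R` opens an active phase.
  preimage⁺ : ∀ Γ P (c : C.Derivation (map lp Γ ⊢[ rf P ]⨟ [])) → CA.Complete c → Preimage {Γ ⊢[ P ]} c
  preimage⁺ Γ P leaf (_ , () ∷ _)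
  preimage⁺ Γ (atom⁺ p) (infer (C.init⁺ r u _) []) _ with image r′ ← atomView Γ r =
    preimage-infer (init⁺ r′ (unrestricted⁻ _ u)) (λ ()) preimage[]
  preimage⁺ Γ (P ⊗ Q) (infer (C.⊗R s []) (c ∷ d ∷ [])) ((_ , p) , ns)
    with image s′ ← splitView Γ s =
    preimage-infer (⊗R s′) (λ ())
      (preimage∷ (preimage⁺ _ P c (CA.Complete-head c (d ∷ []) (p , ns)))
      (preimage∷ (preimage⁺ _ Q d (CA.Complete-head d [] (CA.Complete-tail c (d ∷ []) (p , ns)))) preimage[]))
  preimage⁺ Γ 𝟏 (infer (C.𝟏R u _) []) _ = preimage-infer (𝟏R (unrestricted⁻ Γ u)) (λ ()) preimage[]
  preimage⁺ Γ (P ⊕ Q) (infer C.⊕R₁ (c ∷ [])) ((_ , p) , ns) =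
    preimage-infer ⊕R₁ (λ ()) (preimage∷ (preimage⁺ Γ P c (CA.Complete-head c [] (p , ns))) preimage[])
  preimage⁺ Γ (P ⊕ Q) (infer C.⊕R₂ (c ∷ [])) ((_ , p) , ns) =
    preimage-infer ⊕R₂ (λ ()) (preimage∷ (preimage⁺ Γ Q c (CA.Complete-head c [] (p , ns))) preimage[])
  preimage⁺ Γ (!⟨ z ⟩ A) (infer (C.!R q _) (c ∷ [])) ((_ , p) , ns) =
    preimage-infer (!R (≼̂⇒≼ Γ q)) (λ ())
      (preimage∷ (preimage-active (IA.phase (A ⨟·)) tt (λ ()) c (CA.Complete-head c [] (p , ns))) preimage[])

  preimage⁻ : ∀ Γ N δ (c : C.Derivation (map lp Γ C.⨟[ lf N ]⊢ rp δ ∷ [])) → CA.Complete c →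
              Preimage {Γ ⨟[ N ]⊢ δ} c
  preimage⁻ Γ N δ leaf (_ , () ∷ _)
  preimage⁻ Γ (atom⁻ n) (x ⦂ atom⁻ n) (infer (C.init⁻ here u _) []) _ =
    preimage-infer (init⁻ (unrestricted⁻ Γ u)) (λ ()) preimage[]
  preimage⁻ Γ (atom⁻ n) (x ⦂ pos P) (infer (C.init⁻ (there ()) _ _) []) _
  preimage⁻ Γ (N & M) δ (infer C.&L₁ (c ∷ [])) ((_ , p) , ns) =
    preimage-infer &L₁ (λ ()) (preimage∷ (preimage⁻ Γ N δ c (CA.Complete-head c [] (p , ns))) preimage[])
  preimage⁻ Γ (N & M) δ (infer C.&L₂ (c ∷ [])) ((_ , p) , ns) =
    preimage-infer &L₂ (λ ()) (preimage∷ (preimage⁻ Γ M δ c (CA.Complete-head c [] (p , ns))) preimage[])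
  preimage⁻ Γ (P ⊸ N) δ (infer (C.⊸L s (shared u _)) _) _ = ⊥-elim-irr u
  preimage⁻ Γ (P ⊸ N) δ (infer (C.⊸L s (first _ [])) (c ∷ d ∷ [])) ((_ , p) , ns) =
    contradiction (CA.Complete-head c (d ∷ []) (p , ns)) (no-complete-right-focus P c)
  preimage⁻ Γ (P ⊸ N) δ (infer (C.⊸L s (second _ [])) (c ∷ d ∷ [])) ((_ , p) , ns)
    with image s′ ← splitView Γ s =
    preimage-infer (⊸L s′) (λ ())
      (preimage∷ (preimage⁺ _ P c (CA.Complete-head c (d ∷ []) (p , ns)))
      (preimage∷ (preimage⁻ _ N δ d (CA.Complete-head d [] (CA.Complete-tail c (d ∷ []) (p , ns)))) preimage[]))
  preimage⁻ Γ (?⟨ z ⟩ A) (x ⦂ B) (infer (C.?L q q′) (c ∷ [])) ((_ , p) , ns) =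
    preimage-infer (?L (≼̂⇒≼ Γ q) (≤̂⇒≤ (All.head q′))) (λ ())
      (preimage∷ (preimage-active (IA.phase (·⨟ x ⦂ B)) tt (λ ()) c (CA.Complete-head c [] (p , ns))) preimage[])

  preimage-decision : ∀ {S T} (r : I.Rule decision (S ∷ []) T) {c : C.Derivation (E S)} → Preimage {S} c →
    ∃[ d ] lift (proj₁ {B = I.IsSynthetic {T}} d) C.≈ infer (E-rule r) (c ∷ [])
  preimage-decision r (d , p , e) =
    (infer r (d ∷ []) , refl , IA.Complete-∷ d [] p (tt , [])) , C.infer (E-rule r) (e C.∷ C.[])

  preimage-synthetic : ∀ Γ δ (c : C.Synthetic (map lp Γ ⨟ [] ⊢ [] ⨟ rp δ ∷ [])) →
    ∃[ d ] lift (proj₁ {B = I.IsSynthetic {Γ ⨟ [] ⊢ ·⨟ δ}} d) C.≈ proj₁ c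
  preimage-synthetic Γ (z ⦂ pos P) (infer (decideRʳ here _) (c ∷ []) , refl , p , ns) =
    preimage-decision decideR (preimage⁺ Γ P c (CA.Complete-head c [] (p , ns)))
  preimage-synthetic Γ (z ⦂ atom⁻ n) (infer (decideRʳ (there ()) _) _ , _)
  -- A copying decision needs an unrestricted zone, but no right formula has side `𝗅` and side `𝗋`
  -- is restricted.
  preimage-synthetic Γ (z ⦂ B) (infer (decideRᵘ {z = _ , 𝗅} (there ()) u) _ , _)
  preimage-synthetic Γ (z ⦂ B) (infer (decideRᵘ {z = _ , 𝗋} _ u) _ , _) = ⊥-elim-irr u
  preimage-synthetic Γ δ (infer (C.decideLʳ r u) (c ∷ []) , refl , p , ns)
    with image r′ ← negView Γ r =
    preimage-decision (decideLʳ r′ u) (preimage⁻ _ _ δ c (CA.Complete-head c [] (p , ns)))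
  preimage-synthetic Γ δ (infer (C.decideLᵘ r u) (c ∷ []) , refl , p , ns)
    with image r′ ← negView Γ r =
    preimage-decision (decideLᵘ r′ u) (preimage⁻ _ _ δ c (CA.Complete-head c [] (p , ns)))

  -- The bijection on synthetic derivations

  lift-synthetic-injective : ∀ {S} (d e : I.Synthetic S) → lift (proj₁ d) C.≈ lift (proj₁ e) → proj₁ d I.≈ proj₁ e
  lift-synthetic-injective (infer r ds , refl , c) (infer s es , refl , c′) ≈ =
    infer-injective r s (λ ()) (λ ()) c c′ ≈

  synthetic-bijection : ∀ {S} → I.Neutral S → Bijection (I.synthetic S) (C.synthetic (E S))
  synthetic-bijection (I.neutral {Γ} {δ}) = record
    { to        = λ (d , p) → lift d , IsSynthetic-lift d p
    ; cong      = lift-cong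
    ; bijective = (λ {d} {e} → lift-synthetic-injective d e)
                , (λ c → let d , e = preimage-synthetic Γ δ c in
                         d , λ ≈ → C.≈-trans (lift-cong ≈) e)
    }

  -- Lifting preserves the shape of the derivation, so the premises agree even as lists.
  openPremises-lift : ∀ {S} (n : I.Neutral S) d →
    C.openPremises (Bijection.to (synthetic-bijection n) d) C.↭ˢ map E (I.openPremises d)
  openPremises-lift I.neutral (d , _) = SetoidPermutation.↭-reflexive C.sequents (leaves-lift d)

theorem17 : (𝔸 : Atoms) (Sig : Signature) →
    let module I = ISL 𝔸 Sig
        module C = CSL 𝔸 (split Sig)
        open Encoding 𝔸 Sig using (E)
    in (S : I.Sequent) → I.Neutral S →
       Σ[ f ∈ Bijection (I.synthetic S) (C.synthetic (E S)) ]
         (∀ d → C.openPremises (Bijection.to f d) C.↭ˢ map E (I.openPremises d))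
theorem17 𝔸 Sig S n = synthetic-bijection n , openPremises-lift n
  where open Adequacy 𝔸 Sig
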